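{- Let $G=(V,E)$ be a graph on $n$ vertices with minimum degree $m$, where $m\to\infty$ as $n\to\infty$. For every $\varepsilon>0$ there exists a constant $k_\varepsilon$ such that if $k\geq k_\varepsilon$ then with high probability $G_k$ contains a path of length at least $(1-\varepsilon)m$.
   Context: For a fixed graph $G=(V,E)$ and a positive integer $k$, the random graph $G_k$ is obtained by letting each vertex $v\in V$ independently choose $k$ random neighbors of $v$ in $G$ (uniformly from its $G$-neighborhood), the edges of $G_k$ being all pairs $\{v,w\}$ such that $v$ chose $w$ or $w$ chose $v$. $G$ is one member of a sequence of graphs with $n\to\infty$; "with high probability" means with probability tending to $1$ as $n\to\infty$ (equivalently, as $m\to\infty$). -}

module Defs where

open import Data.Fin.Base using (Fin; zero; suc; toℕ; fromℕ<)
open import Data.Fin.Properties as Fin using (any?; injective⇒≤; toℕ-fromℕ<)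
open import Data.Fin.Subset using (Subset; inside; outside; _∈_; ∣_∣)
open import Data.Fin.Subset.Properties using (_∈?_; _⊆?_)
open import Data.Integer.Base using (+_)
open import Data.List.Base using (List; []; _∷_; filter; length; cartesianProductWith)
open import Data.Nat.Base as ℕ using (ℕ; zero; suc)
import Data.Nat.Properties as ℕ
open import Data.Product.Base using (∃; ∃-syntax; _×_; _,_)
open import Data.Rational.Base as ℚ using (ℚ; 0ℚ; _/_; _-_; _≤_; _<_)
import Data.Rational.Properties as ℚ
open import Data.Sum.Base using (_⊎_)
open import Data.Vec.Base using (Vec; []; _∷_; lookup; tabulate)
open import Data.Vec.Relation.Unary.AllPairs using (allPairs?)
open import Data.Vec.Relation.Unary.Linked using (Linked; linked?)
open import Data.Vec.Relation.Unary.Unique.Propositional using (Unique)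
open import Data.Vec.Relation.Unary.Unique.Propositional.Properties using (lookup-injective)
open import Level using (0ℓ)
open import Relation.Binary.Core using (Rel)
import Relation.Binary.Definitions as B
open import Relation.Binary.PropositionalEquality using (_≡_; sym; subst)
open import Relation.Nullary.Decidable using (Dec; does; map′; ¬?; _×-dec_; _⊎-dec_)
open import Relation.Unary using (Pred; Decidable)

fromℕ : ℕ → ℚ
fromℕ n = + n / 1

TendsToInfinity : (ℕ → ℕ) → Set
TendsToInfinity f = ∀ M → ∃[ N ] (∀ i → N ℕ.≤ i → M ℕ.≤ f i)

ConvergesTo : (ℕ → ℚ) → ℚ → Set
ConvergesTo f L = ∀ δ → 0ℚ < δ → ∃[ N ] (∀ i → N ℕ.≤ i → ℚ.∣ f i - L ∣ < δ)

record Graph (n : ℕ) : Set₁ where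
  field
    Adj    : Rel (Fin n) 0ℓ
    adj?   : B.Decidable Adj
    symm   : B.Symmetric Adj
    irrefl : B.Irreflexive _≡_ Adj

  neighbours : Fin n → Subset n
  neighbours v = tabulate (λ w → does (adj? v w))

  degree : Fin n → ℕ
  degree v = ∣ neighbours v ∣

open Graph public

IsMinDegree : ∀ {n} → Graph n → ℕ → Set
IsMinDegree G m = (∀ v → m ℕ.≤ degree G v) × (∃[ v ] degree G v ≡ m)

-- The length ℓ of a path is its number of edges; it has ℓ + 1 vertices.

Path : ∀ {n} → Rel (Fin n) 0ℓ → ℕ → Set
Path {n} E ℓ = ∃[ p ] (Unique p × Linked E {suc ℓ} p)

HasPathOfLength≥ : ∀ {n} → ℚ → Rel (Fin n) 0ℓ → Set
HasPathOfLength≥ q E = ∃[ ℓ ] (q ≤ fromℕ ℓ × Path E ℓ)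

anyVec? : ∀ {n} m {P : Pred (Vec (Fin n) m) 0ℓ} → Decidable P → Dec (∃ P)
anyVec? zero    P? = map′ (λ p → [] , p) (λ { ([] , p) → p }) (P? [])
anyVec? (suc m) P? =
  map′ (λ { (x , xs , p) → x ∷ xs , p }) (λ { (x ∷ xs , p) → x , xs , p })
       (any? (λ x → anyVec? m (λ xs → P? (x ∷ xs))))

path? : ∀ {n} {E : Rel (Fin n) 0ℓ} → B.Decidable E → Decidable (Path E)
path? E? ℓ =
  anyVec? (suc ℓ) (λ p → allPairs? (λ x y → ¬? (x Fin.≟ y)) p ×-dec linked? E? p)

path-length< : ∀ {n ℓ} {E : Rel (Fin n) 0ℓ} → Path E ℓ → ℓ ℕ.< n
path-length< (p , unique , _) =
  injective⇒≤ {f = lookup p} (λ {i} {j} → lookup-injective unique i j)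

hasPathOfLength≥? : ∀ {n} q {E : Rel (Fin n) 0ℓ} → B.Decidable E →
                    Dec (HasPathOfLength≥ q E)
hasPathOfLength≥? {n} q {E} E? =
  map′ (λ { (i , r) → toℕ i , r })
       (λ { (ℓ , r@(_ , p)) →
            fromℕ< (path-length< p) ,
            subst Q (sym (toℕ-fromℕ< (path-length< p))) r })
       (any? (λ i → (q ℚ.≤? fromℕ (toℕ i)) ×-dec path? E? (toℕ i)))
  where
  Q : ℕ → Set
  Q ℓ = q ≤ fromℕ ℓ × Path E ℓ

-- Finite uniform probability.  A sample space is a list enumerating its
-- points without repetition.  The value 0 on the empty space is a
-- convention.

ratio : ℕ → ℕ → ℚ
ratio a zero    = 0ℚ
ratio a (suc b) = + a / suc b

Pr : ∀ {Ω : Set} {A : Pred Ω 0ℓ} → List Ω → Decidable A → ℚ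
Pr space A? = ratio (length (filter A? space)) (length space)

productVec : ∀ {A : Set} {m} → (Fin m → List A) → List (Vec A m)
productVec {m = zero}  f = [] ∷ []
productVec {m = suc m} f =
  cartesianProductWith _∷_ (f zero) (productVec (λ i → f (suc i)))

subsets : ∀ n → List (Subset n)
subsets n = productVec {m = n} (λ _ → outside ∷ inside ∷ [])

-- The random graph G_k: every vertex v chooses a uniformly random k-element
-- subset of its neighbourhood.  The uniform distribution on the product of
-- the individual sample spaces makes the choices independent.

choices : ∀ {n} → Graph n → ℕ → Fin n → List (Subset n)
choices {n} G k v =
  filter (λ s → (s ⊆? neighbours G v) ×-dec (∣ s ∣ ℕ.≟ k)) (subsets n)

outcomes : ∀ {n} → Graph n → ℕ → List (Vec (Subset n) n)
outcomes G k = productVec (choices G k)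

ChosenAdj : ∀ {n} → Vec (Subset n) n → Rel (Fin n) 0ℓ
ChosenAdj ω v w = w ∈ lookup ω v ⊎ v ∈ lookup ω w

chosenAdj? : ∀ {n} (ω : Vec (Subset n) n) → B.Decidable (ChosenAdj ω)
chosenAdj? ω v w = (w ∈? lookup ω v) ⊎-dec (v ∈? lookup ω w)

PrPath≥ : ∀ {n} → Graph n → ℕ → ℚ → ℚ
PrPath≥ G k q =
  Pr {A = λ ω → HasPathOfLength≥ q (ChosenAdj ω)}
     (outcomes G k) (λ ω → hasPathOfLength≥? q (chosenAdj? ω))

{-# OPTIONS --safe #-}

-- Run a depth-first search in which the vertex on top of the stack reveals the
-- elements of its random k-set one at a time; a vertex is dead once all k are
-- revealed.  The stack is always a path of G_k.  As long as fewer than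
-- (1 - 1/q) m vertices have been visited, a new element is an unvisited vertex
-- with conditional probability at least 1/q.  After k s revelations at most s
-- vertices are dead, so if s + ℓ + 1 vertices have been visited by then, the
-- stack has more than ℓ vertices.  Hence the weight
-- 2 ^ (visits missing) * (1 - 1 / (2 q)) ^ (revelations left) bounds the
-- conditional probability that no path of length ℓ exists; for k large in terms
-- of q the initial weight is exponentially small in m, uniformly in n.
module Submission where

open import Defs
open import Algebra.Properties.CommutativeMonoid.Sum as Product using ()
open import Algebra.Properties.Semiring.Sum as Sum using ()
open import Data.Bool.Base using (if_then_else_)
open import Data.Fin.Base using (Fin; zero; suc)
open import Data.Fin.Properties as Fin using (any?)
open import Data.Fin.Subset using (Subset; inside; outside; _∈_; _∉_; _⊆_; _∪_; _─_; ⁅_⁆; ⊥; ⊤; ∣_∣)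
open import Data.Fin.Subset.Properties
open import Data.Integer.Base as ℤ using (+<+; +≤+)
import Data.Integer.Properties as ℤ
open import Data.List.Base as List using (List; []; _∷_; filter; length; cartesianProductWith)
open import Data.List.Relation.Unary.All as All using (All; []; _∷_)
open import Data.List.Relation.Unary.All.Properties as All using (all-filter)
open import Data.Nat.Base as ℕ using (ℕ; zero; suc; NonZero; _+_; _*_; _∸_; _^_; _≤_; _<_; z≤n; s≤s; s≤s⁻¹)
open import Data.Nat.Combinatorics using (_C_; nCk+nC[k+1]≡[n+1]C[k+1]; nC1≡n)
open import Data.Nat.DivMod using (_/_; _%_; m≡m%n+[m/n]*n; m%n<n; m/n*n≤m; /-monoˡ-≤; m*n/n≡m)
open import Data.Nat.Properties as ℕ
open import Data.Nat.Tactic.RingSolver using (solve-∀)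
open import Data.Product.Base using (∃-syntax; _×_; _,_; proj₁; proj₂)
open import Data.Rational.Base as ℚ using (ℚ; mkℚ; 0ℚ; 1ℚ; fromℚᵘ; toℚᵘ; ↧ₙ_; *<*)
import Data.Rational.Properties as ℚ
open import Data.Rational.Unnormalised.Base as ℚᵘ using (mkℚᵘ; *≡*; *≤*; *<*)
import Data.Rational.Unnormalised.Properties as ℚᵘ
open import Data.Sum.Base using (inj₁; inj₂)
open import Data.Vec.Base as Vec using (Vec; []; _∷_; lookup; here; there)
open import Data.Vec.Functional using (updateAt)
open import Data.Vec.Functional.Properties using (updateAt-updates; updateAt-minimal)
open import Data.Vec.Relation.Unary.All as VecAll using ([]; _∷_)
open import Data.Vec.Relation.Unary.AllPairs using ([]; _∷_)
open import Data.Vec.Relation.Unary.Linked as Linked using (Linked; []; [-]; _∷_)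
open import Data.Vec.Relation.Unary.Unique.Propositional using (Unique)
open import Function.Base using (id; _∘_)
open import Relation.Binary.PropositionalEquality
open import Relation.Nullary.Decidable
  using (Dec; yes; no; does; _×-dec_; ¬?; dec-true; dec-false; decidable-stable)
open import Relation.Nullary.Negation using (¬_; contradiction)
open import Relation.Unary using (Decidable)

open Sum +-*-semiring
  using (sum; sum-cong-≗; ∑-distrib-+; *-distribˡ-sum; *-distribʳ-sum; sum-replicate-zero)
open Product *-1-commutativeMonoid using () renaming (sum to product)

-- Indicators, finite sums and counting

𝟙 : {P : Set} → Dec P → ℕ
𝟙 P? = if does P? then 1 else 0

𝟙-yes : {P : Set} (P? : Dec P) → P → 𝟙 P? ≡ 1
𝟙-yes P? p = cong (if_then 1 else 0) (dec-true P? p)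

𝟙-no : {P : Set} (P? : Dec P) → ¬ P → 𝟙 P? ≡ 0
𝟙-no P? ¬p = cong (if_then 1 else 0) (dec-false P? ¬p)

𝟙≤1 : {P : Set} (P? : Dec P) → 𝟙 P? ≤ 1
𝟙≤1 (yes _) = ≤-refl
𝟙≤1 (no _)  = z≤n

sum-mono-≤ : ∀ {n} {f g : Fin n → ℕ} → (∀ i → f i ≤ g i) → sum f ≤ sum g
sum-mono-≤ {zero}  f≤g = z≤n
sum-mono-≤ {suc n} f≤g = +-mono-≤ (f≤g zero) (sum-mono-≤ (f≤g ∘ suc))

∣p∣≡∑ : ∀ {n} (p : Subset n) → ∣ p ∣ ≡ sum (λ a → 𝟙 (a ∈? p))
∣p∣≡∑ []            = refl
∣p∣≡∑ (inside ∷ p)  = cong suc (∣p∣≡∑ p)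
∣p∣≡∑ (outside ∷ p) = ∣p∣≡∑ p

x∈p─q⇒x∉q : ∀ {n} {x : Fin n} (p q : Subset n) → x ∈ p ─ q → x ∉ q
x∈p─q⇒x∉q (_ ∷ p) (outside ∷ q) (there x∈) (there x∈q) = x∈p─q⇒x∉q p q x∈ x∈q
x∈p─q⇒x∉q (_ ∷ p) (inside ∷ q)  (there x∈) (there x∈q) = x∈p─q⇒x∉q p q x∈ x∈q

∣p∪⁅x⁆∣ : ∀ {n} (p : Subset n) {x} → x ∉ p → ∣ p ∪ ⁅ x ⁆ ∣ ≡ suc ∣ p ∣
∣p∪⁅x⁆∣ (inside ∷ p)  {zero}  x∉p = contradiction here x∉p
∣p∪⁅x⁆∣ (outside ∷ p) {zero}  x∉p = cong (suc ∘ ∣_∣) (∪-identityʳ p)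
∣p∪⁅x⁆∣ (inside ∷ p)  {suc x} x∉p = cong suc (∣p∪⁅x⁆∣ p (x∉p ∘ there))
∣p∪⁅x⁆∣ (outside ∷ p) {suc x} x∉p = ∣p∪⁅x⁆∣ p (x∉p ∘ there)

∪⁅⁆-⊆ : ∀ {n} {p q : Subset n} {x} → p ⊆ q → x ∈ q → p ∪ ⁅ x ⁆ ⊆ q
∪⁅⁆-⊆ {p = p} {q} {x} p⊆q x∈q y∈ with x∈p∪q⁻ p ⁅ x ⁆ y∈
... | inj₁ y∈p = p⊆q y∈p
... | inj₂ y∈x = subst (_∈ q) (sym (x∈⁅y⁆⇒x≡y x y∈x)) x∈q

x∈p∪⁅x⁆ : ∀ {n} (p : Subset n) x → x ∈ p ∪ ⁅ x ⁆
x∈p∪⁅x⁆ p x = q⊆p∪q p ⁅ x ⁆ (x∈⁅x⁆ x)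

∣p─q∣+∣q∣ : ∀ {n} (p q : Subset n) → q ⊆ p → ∣ p ─ q ∣ + ∣ q ∣ ≡ ∣ p ∣
∣p─q∣+∣q∣ []            []            q⊆p = refl
∣p─q∣+∣q∣ (inside ∷ p)  (inside ∷ q)  q⊆p =
  trans (+-suc ∣ p ─ q ∣ ∣ q ∣) (cong suc (∣p─q∣+∣q∣ p q (drop-∷-⊆ q⊆p)))
∣p─q∣+∣q∣ (inside ∷ p)  (outside ∷ q) q⊆p = cong suc (∣p─q∣+∣q∣ p q (drop-∷-⊆ q⊆p))
∣p─q∣+∣q∣ (outside ∷ p) (inside ∷ q)  q⊆p = contradiction (q⊆p here) λ ()
∣p─q∣+∣q∣ (outside ∷ p) (outside ∷ q) q⊆p = ∣p─q∣+∣q∣ p q (drop-∷-⊆ q⊆p)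

-- Sums over lists and over product spaces

total : {A : Set} → (A → ℕ) → List A → ℕ
total f []       = 0
total f (x ∷ xs) = f x + total f xs

module _ {A : Set} where

  total-cong : {f g : A → ℕ} → (∀ x → f x ≡ g x) → ∀ xs → total f xs ≡ total g xs
  total-cong f≗g []       = refl
  total-cong f≗g (x ∷ xs) = cong₂ _+_ (f≗g x) (total-cong f≗g xs)

  total-mono-≤ : ∀ {f g : A → ℕ} {xs} → All (λ x → f x ≤ g x) xs → total f xs ≤ total g xs
  total-mono-≤ []           = z≤n
  total-mono-≤ (fx≤gx ∷ fs) = +-mono-≤ fx≤gx (total-mono-≤ fs)

  total-* : ∀ c (f : A → ℕ) xs → total (λ x → c * f x) xs ≡ c * total f xs
  total-* c f []       = sym (*-zeroʳ c)
  total-* c f (x ∷ xs) =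
    trans (cong (c * f x +_) (total-* c f xs)) (sym (*-distribˡ-+ c (f x) (total f xs)))

  total-zero : {f : A → ℕ} → (∀ x → f x ≡ 0) → ∀ xs → total f xs ≡ 0
  total-zero f≗0 []       = refl
  total-zero f≗0 (x ∷ xs) = cong₂ _+_ (f≗0 x) (total-zero f≗0 xs)

  total-one : (xs : List A) → total (λ _ → 1) xs ≡ length xs
  total-one []       = refl
  total-one (x ∷ xs) = cong suc (total-one xs)

  total-++ : ∀ (f : A → ℕ) xs ys → total f (xs List.++ ys) ≡ total f xs + total f ys
  total-++ f []       ys = refl
  total-++ f (x ∷ xs) ys =
    trans (cong (f x +_) (total-++ f xs ys)) (sym (+-assoc (f x) (total f xs) (total f ys)))

  total-map : ∀ {B : Set} (f : A → ℕ) (g : B → A) xs → total f (List.map g xs) ≡ total (f ∘ g) xs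
  total-map f g []       = refl
  total-map f g (x ∷ xs) = cong (f (g x) +_) (total-map f g xs)

  total-filter : ∀ {P : A → Set} (P? : Decidable P) f xs →
                 total f (filter P? xs) ≡ total (λ x → 𝟙 (P? x) * f x) xs
  total-filter P? f []       = refl
  total-filter P? f (x ∷ xs) with P? x
  ... | yes _ = cong₂ _+_ (sym (+-identityʳ (f x))) (total-filter P? f xs)
  ... | no  _ = total-filter P? f xs

  length-filter+ : ∀ {P : A → Set} (P? : Decidable P) xs →
                   length (filter P? xs) + total (λ x → 𝟙 (¬? (P? x))) xs ≡ length xs
  length-filter+ P? []       = refl
  length-filter+ P? (x ∷ xs) with P? x
  ... | yes _ = cong suc (length-filter+ P? xs)
  ... | no  _ = trans (+-suc _ _) (cong suc (length-filter+ P? xs))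

  total-∑ : ∀ {n} (f : Fin n → A → ℕ) xs →
            total (λ x → sum (λ i → f i x)) xs ≡ sum (λ i → total (f i) xs)
  total-∑ {n} f []       = sym (sum-replicate-zero n)
  total-∑ {n} f (x ∷ xs) =
    trans (cong (sum (λ i → f i x) +_) (total-∑ f xs))
          (sym (∑-distrib-+ (λ i → f i x) (λ i → total (f i) xs)))

-- Independence of the coordinates: distributivity splits off one coordinate of the Cartesian
-- product at a time.
total-productVec : ∀ {A : Set} {m} (xs : Fin m → List A) (f : Fin m → A → ℕ) →
  total (λ ω → product (λ v → f v (lookup ω v))) (productVec xs) ≡
  product (λ v → total (f v) (xs v))
total-productVec {_} {zero}  xs f = refl
total-productVec {A} {suc m} xs f = go (xs zero)
  where
  ys = productVec (λ i → xs (suc i))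
  F : Vec A (suc m) → ℕ
  F ω = product (λ v → f v (lookup ω v))
  P = product (λ v → total (f (suc v)) (xs (suc v)))
  go : ∀ zs → total F (cartesianProductWith _∷_ zs ys) ≡ total (f zero) zs * P
  go []       = refl
  go (z ∷ zs) = begin
    total F (List.map (z ∷_) ys List.++ cartesianProductWith _∷_ zs ys)
      ≡⟨ total-++ F (List.map (z ∷_) ys) _ ⟩
    total F (List.map (z ∷_) ys) + total F (cartesianProductWith _∷_ zs ys)
      ≡⟨ cong₂ _+_ (total-map F (z ∷_) ys) (go zs) ⟩
    total (λ ω → f zero z * product (λ v → f (suc v) (lookup ω v))) ys + total (f zero) zs * P
      ≡⟨ cong (_+ _) (total-* (f zero z) _ ys) ⟩
    f zero z * total (λ ω → product (λ v → f (suc v) (lookup ω v))) ys + total (f zero) zs * P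
      ≡⟨ cong (λ t → f zero z * t + total (f zero) zs * P)
           (total-productVec (λ i → xs (suc i)) (λ i → f (suc i))) ⟩
    f zero z * P + total (f zero) zs * P
      ≡⟨ *-distribʳ-+ P (f zero z) (total (f zero) zs) ⟨
    (f zero z + total (f zero) zs) * P ∎
    where open ≡-Reasoning

-- `R` is the product of the factors away from `u`. The same `R` serves the original family and
-- every update of it, so the two products can be compared without division.
product-updateAt : ∀ {A : Set} {n} (F : Fin n → A → ℕ) (xs : Fin n → A) u →
  ∃[ R ] (product (λ v → F v (xs v)) ≡ F u (xs u) * R ×
          (∀ f → product (λ v → F v (updateAt xs u f v)) ≡ F u (f (xs u)) * R))
product-updateAt F xs zero = _ , refl , λ f → refl
product-updateAt F xs (suc u) with product-updateAt (F ∘ suc) (xs ∘ suc) u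
... | R , eq , eqs = F₀ * R , trans (cong (F₀ *_) eq) (swap (F (suc u) (xs (suc u)))) ,
                     λ f → trans (cong (F₀ *_) (eqs f)) (swap (F (suc u) (f (xs (suc u)))))
  where
  F₀ = F zero (xs zero)
  swap : ∀ y → F₀ * (y * R) ≡ y * (F₀ * R)
  swap y = x∙yz F₀ y R
    where
    x∙yz : ∀ a b c → a * (b * c) ≡ b * (a * c)
    x∙yz = solve-∀

product≡0 : ∀ {n} (f : Fin n → ℕ) u → f u ≡ 0 → product f ≡ 0
product≡0 f zero    fu≡0 = cong (_* product (f ∘ suc)) fu≡0
product≡0 f (suc u) fu≡0 = trans (cong (f zero *_) (product≡0 (f ∘ suc) u fu≡0)) (*-zeroʳ (f zero))

product≡1 : ∀ {n} (f : Fin n → ℕ) → (∀ v → f v ≡ 1) → product f ≡ 1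
product≡1 {zero}  f f≗1 = refl
product≡1 {suc n} f f≗1 = cong₂ _*_ (f≗1 zero) (product≡1 (f ∘ suc) (f≗1 ∘ suc))

product-pos : ∀ {n} (f : Fin n → ℕ) → (∀ v → 1 ≤ f v) → 1 ≤ product f
product-pos {zero}  f 1≤f = ≤-refl
product-pos {suc n} f 1≤f = *-mono-≤ (1≤f zero) (product-pos (f ∘ suc) (1≤f ∘ suc))

-- Binomial coefficients and sets between two given sets

[k+1]*[n+1]C[k+1]≡[n+1]*nCk : ∀ n k → suc k * (suc n C suc k) ≡ suc n * (n C k)
[k+1]*[n+1]C[k+1]≡[n+1]*nCk n zero = trans (+-identityʳ _) (trans (nC1≡n (suc n)) (sym (*-identityʳ (suc n))))
[k+1]*[n+1]C[k+1]≡[n+1]*nCk zero (suc k) = trans (*-zeroʳ (suc (suc k))) (sym (*-zeroʳ 1))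
[k+1]*[n+1]C[k+1]≡[n+1]*nCk (suc n) (suc k) = begin
  (2 + k) * (suc (suc n) C suc (suc k))
    ≡⟨ cong ((2 + k) *_) (nCk+nC[k+1]≡[n+1]C[k+1] (suc n) (suc k)) ⟨
  (2 + k) * ((suc n C suc k) + (suc n C suc (suc k)))
    ≡⟨ expand k (suc n C suc k) _ ⟩
  (suc n C suc k) + (suc k * (suc n C suc k) + (2 + k) * (suc n C suc (suc k)))
    ≡⟨ cong (λ t → (suc n C suc k) + t)
         (cong₂ _+_ ([k+1]*[n+1]C[k+1]≡[n+1]*nCk n k) ([k+1]*[n+1]C[k+1]≡[n+1]*nCk n (suc k))) ⟩
  (suc n C suc k) + (suc n * (n C k) + suc n * (n C suc k))
    ≡⟨ cong ((suc n C suc k) +_) (*-distribˡ-+ (suc n) (n C k) (n C suc k)) ⟨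
  (suc n C suc k) + suc n * ((n C k) + (n C suc k))
    ≡⟨ cong (λ t → (suc n C suc k) + suc n * t) (nCk+nC[k+1]≡[n+1]C[k+1] n k) ⟩
  (2 + n) * (suc n C suc k) ∎
  where
  open ≡-Reasoning
  expand : ∀ k x y → (2 + k) * (x + y) ≡ x + ((1 + k) * x + (2 + k) * y)
  expand = solve-∀

interval? : ∀ {n} (p q : Subset n) k (s : Subset n) → Dec ((s ⊆ q × ∣ s ∣ ≡ k) × p ⊆ s)
interval? p q k s = ((s ⊆? q) ×-dec (∣ s ∣ ≟ k)) ×-dec (p ⊆? s)

total-subsets : ∀ n (f : Subset (suc n) → ℕ) →
  total f (subsets (suc n)) ≡
  total (λ s → f (outside ∷ s)) (subsets n) + total (λ s → f (inside ∷ s)) (subsets n)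
total-subsets n f = begin
  total f (List.map (outside ∷_) S List.++ (List.map (inside ∷_) S List.++ []))
    ≡⟨ total-++ f (List.map (outside ∷_) S) _ ⟩
  total f (List.map (outside ∷_) S) + total f (List.map (inside ∷_) S List.++ [])
    ≡⟨ cong₂ _+_ (total-map f (outside ∷_) S)
         (trans (total-++ f (List.map (inside ∷_) S) [])
         (trans (+-identityʳ _) (total-map f (inside ∷_) S))) ⟩
  total (λ s → f (outside ∷ s)) S + total (λ s → f (inside ∷ s)) S ∎
  where
  open ≡-Reasoning
  S = subsets n

-- Such a set `s` amounts to a choice of `j` elements of `q ─ p`, which has `δ` elements. A
-- coordinate in `q` but not in `p` gives Pascal's rule; every other coordinate of `s` is forced.
#interval : ∀ {n} (p q : Subset n) j δ → p ⊆ q → ∣ q ∣ ≡ δ + ∣ p ∣ →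
            total (λ s → 𝟙 (interval? p q (j + ∣ p ∣) s)) (subsets n) ≡ δ C j
#interval [] [] zero    zero p⊆q ∣q∣≡ = refl
#interval [] [] (suc j) zero p⊆q ∣q∣≡ = refl
#interval {suc n} (inside ∷ p) (outside ∷ q) j δ p⊆q ∣q∣≡ = contradiction (p⊆q here) λ ()
#interval {suc n} (outside ∷ p) (outside ∷ q) j δ p⊆q ∣q∣≡ =
  trans (total-subsets n _) (trans
    (cong₂ _+_ (#interval p q j δ (drop-∷-⊆ p⊆q) ∣q∣≡) (total-zero none (subsets n)))
    (+-identityʳ _))
  where
  none : ∀ s → 𝟙 (interval? (outside ∷ p) (outside ∷ q) (j + ∣ p ∣) (inside ∷ s)) ≡ 0
  none s = 𝟙-no (interval? (outside ∷ p) (outside ∷ q) (j + ∣ p ∣) (inside ∷ s))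
    λ { ((s⊆q , _) , _) → contradiction (s⊆q here) λ () }
#interval {suc n} (inside ∷ p) (inside ∷ q) j δ p⊆q ∣q∣≡ rewrite +-suc j ∣ p ∣ =
  trans (total-subsets n _) (cong₂ _+_ (total-zero none (subsets n))
    (#interval p q j δ (drop-∷-⊆ p⊆q) (suc-injective (trans ∣q∣≡ (+-suc δ ∣ p ∣)))))
  where
  none : ∀ s → 𝟙 (interval? (inside ∷ p) (inside ∷ q) (suc (j + ∣ p ∣)) (outside ∷ s)) ≡ 0
  none s = 𝟙-no (interval? (inside ∷ p) (inside ∷ q) (suc (j + ∣ p ∣)) (outside ∷ s))
    λ { (_ , p⊆s) → contradiction (p⊆s here) λ () }
#interval {suc n} (outside ∷ p) (inside ∷ q) j zero p⊆q ∣q∣≡ =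
  contradiction (p⊆q⇒∣p∣≤∣q∣ (drop-∷-⊆ p⊆q)) (<⇒≱ (≤-reflexive ∣q∣≡))
#interval {suc n} (outside ∷ p) (inside ∷ q) zero (suc δ) p⊆q ∣q∣≡ =
  trans (total-subsets n _) (cong₂ _+_
    (#interval p q 0 δ (drop-∷-⊆ p⊆q) (suc-injective ∣q∣≡)) (total-zero none (subsets n)))
  where
  none : ∀ s → 𝟙 (interval? (outside ∷ p) (inside ∷ q) ∣ p ∣ (inside ∷ s)) ≡ 0
  none s = 𝟙-no (interval? (outside ∷ p) (inside ∷ q) ∣ p ∣ (inside ∷ s))
    λ { ((_ , ∣s∣≡) , p⊆s) →
        contradiction (p⊆q⇒∣p∣≤∣q∣ (drop-∷-⊆ p⊆s)) (<⇒≱ (≤-reflexive ∣s∣≡)) }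
#interval {suc n} (outside ∷ p) (inside ∷ q) (suc j) (suc δ) p⊆q ∣q∣≡ =
  trans (total-subsets n _) (trans (cong₂ _+_
    (#interval p q (suc j) δ (drop-∷-⊆ p⊆q) (suc-injective ∣q∣≡))
    (#interval p q j δ (drop-∷-⊆ p⊆q) (suc-injective ∣q∣≡)))
    (trans (+-comm (δ C suc j) (δ C j)) (nCk+nC[k+1]≡[n+1]C[k+1] δ j)))

𝟙-× : {P Q : Set} (P? : Dec P) (Q? : Dec Q) → 𝟙 P? * 𝟙 Q? ≡ 𝟙 (P? ×-dec Q?)
𝟙-× (yes _) Q? = +-identityʳ (𝟙 Q?)
𝟙-× (no _)  Q? = refl

productVec⁺ : ∀ {A : Set} {m} {P : Fin m → A → Set} {xs : Fin m → List A} →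
              (∀ v → All (P v) (xs v)) → All (λ ω → ∀ v → P v (lookup ω v)) (productVec xs)
productVec⁺ {m = zero}  Pxs = (λ ()) ∷ []
productVec⁺ {m = suc m} {P} {xs} Pxs = go (Pxs zero)
  where
  go : ∀ {zs} → All (P zero) zs →
       All (λ ω → ∀ v → P v (lookup ω v)) (cartesianProductWith _∷_ zs (productVec (xs ∘ suc)))
  go []         = []
  go (Pz ∷ Pzs) =
    All.++⁺ (All.map⁺ (All.map (λ Pω → λ { zero → Pz ; (suc v) → Pω v }) (productVec⁺ {xs = xs ∘ suc} (λ v → Pxs (suc v)))))
            (go Pzs)

-- If `s` contains `p`, then `s` has `j` elements outside `p`, all of them in `q`, and adding any
-- one of them to `p` stays inside `s`.
∑∈─≥ : ∀ {n} (p q s : Subset n) j → s ⊆ q → ∣ s ∣ ≡ j + ∣ p ∣ →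
       j * 𝟙 (p ⊆? s) ≤ sum (λ a → 𝟙 (a ∈? q ─ p) * 𝟙 (p ∪ ⁅ a ⁆ ⊆? s))
∑∈─≥ p q s j s⊆q ∣s∣≡ with p ⊆? s
... | no _ = ≤-trans (≤-reflexive (*-zeroʳ j)) z≤n
... | yes p⊆s = ≤-trans (≤-reflexive (*-identityʳ j)) (+-cancelʳ-≤ ∣ p ∣ _ _ (begin
  j + ∣ p ∣                                ≡⟨ ∣s∣≡ ⟨
  ∣ s ∣                                    ≡⟨ ∣p∣≡∑ s ⟩
  sum (λ a → 𝟙 (a ∈? s))                   ≤⟨ sum-mono-≤ pointwise ⟩
  sum (λ a → f a + 𝟙 (a ∈? p))             ≡⟨ ∑-distrib-+ f (λ a → 𝟙 (a ∈? p)) ⟩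
  sum f + sum (λ a → 𝟙 (a ∈? p))           ≡⟨ cong (sum f +_) (∣p∣≡∑ p) ⟨
  sum f + ∣ p ∣                            ∎))
  where
  open ≤-Reasoning
  f : Fin _ → ℕ
  f a = 𝟙 (a ∈? q ─ p) * 𝟙 (p ∪ ⁅ a ⁆ ⊆? s)
  pointwise : ∀ a → 𝟙 (a ∈? s) ≤ f a + 𝟙 (a ∈? p)
  pointwise a with a ∈? s | a ∈? p
  ... | no _    | _       = z≤n
  ... | yes _   | yes _   = m≤n+m 1 (f a)
  ... | yes a∈s | no  a∉p = ≤-reflexive (sym (trans (+-identityʳ (f a)) (cong₂ _*_
    (𝟙-yes (a ∈? q ─ p) (x∈p∧x∉q⇒x∈p─q (s⊆q a∈s) a∉p))
    (𝟙-yes (p ∪ ⁅ a ⁆ ⊆? s) (∪⁅⁆-⊆ p⊆s a∈s)))))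

-- Revealing the random choices one element at a time

module Exposure {n} (G : Graph n) (k : ℕ) where

  supersets : Fin n → Subset n → ℕ
  supersets v p = total (λ s → 𝟙 (p ⊆? s)) (choices G k v)

  supersets≡ : ∀ v p j δ → p ⊆ neighbours G v → ∣ neighbours G v ∣ ≡ δ + ∣ p ∣ → k ≡ j + ∣ p ∣ →
               supersets v p ≡ δ C j
  supersets≡ v p j δ p⊆N ∣N∣≡ refl = begin
    supersets v p
      ≡⟨ total-filter (λ s → (s ⊆? neighbours G v) ×-dec (∣ s ∣ ≟ k)) (λ s → 𝟙 (p ⊆? s)) (subsets n) ⟩
    total (λ s → 𝟙 ((s ⊆? neighbours G v) ×-dec (∣ s ∣ ≟ k)) * 𝟙 (p ⊆? s)) (subsets n)
      ≡⟨ total-cong (λ s → 𝟙-× ((s ⊆? neighbours G v) ×-dec (∣ s ∣ ≟ k)) (p ⊆? s)) (subsets n) ⟩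
    total (λ s → 𝟙 (interval? p (neighbours G v) k s)) (subsets n)
      ≡⟨ #interval p (neighbours G v) j δ p⊆N ∣N∣≡ ⟩
    δ C j ∎
    where open ≡-Reasoning

  -- The next element of the choice of `v` is uniform: the two counts are binomial coefficients, and
  -- the absorption identity gives their ratio, which does not depend on `a`.
  supersets-∪⁅⁆ : ∀ v p j {a} → p ⊆ neighbours G v → a ∈ neighbours G v ─ p → k ≡ suc j + ∣ p ∣ →
                  ∣ neighbours G v ─ p ∣ * supersets v (p ∪ ⁅ a ⁆) ≡ suc j * supersets v p
  supersets-∪⁅⁆ v p j {a} p⊆N a∈ k≡ = begin
    ∣ N ─ p ∣ * supersets v p′  ≡⟨ cong₂ _*_ ∣N─p∣≡ (supersets≡ v p′ j δ p′⊆N (sym (∣p─q∣+∣q∣ N p′ p′⊆N))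
                                     (trans k≡ (trans (sym (+-suc j ∣ p ∣)) (cong (j +_) (sym ∣p′∣≡))))) ⟩
    suc δ * (δ C j)             ≡⟨ [k+1]*[n+1]C[k+1]≡[n+1]*nCk δ j ⟨
    suc j * (suc δ C suc j)     ≡⟨ cong (suc j *_) (supersets≡ v p (suc j) (suc δ) p⊆N ∣N∣≡ k≡) ⟨
    suc j * supersets v p       ∎
    where
    open ≡-Reasoning
    N = neighbours G v
    p′ = p ∪ ⁅ a ⁆
    p′⊆N : p′ ⊆ N
    p′⊆N = ∪⁅⁆-⊆ p⊆N (p─q⊆p N p a∈)
    δ = ∣ N ─ p′ ∣
    ∣p′∣≡ : ∣ p′ ∣ ≡ suc ∣ p ∣
    ∣p′∣≡ = ∣p∪⁅x⁆∣ p (x∈p─q⇒x∉q N p a∈)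
    ∣N∣≡ : ∣ N ∣ ≡ suc δ + ∣ p ∣
    ∣N∣≡ = trans (sym (∣p─q∣+∣q∣ N p′ p′⊆N)) (trans (cong (δ +_) ∣p′∣≡) (+-suc δ ∣ p ∣))
    ∣N─p∣≡ : ∣ N ─ p ∣ ≡ suc δ
    ∣N─p∣≡ = +-cancelʳ-≡ ∣ p ∣ _ _ (trans (∣p─q∣+∣q∣ N p p⊆N) ∣N∣≡)

  Exposed : Set
  Exposed = Fin n → Subset n

  expose : Exposed → Fin n → Fin n → Exposed
  expose E u a = updateAt E u (_∪ ⁅ a ⁆)

  -- The indicator that `ω` extends `E`, written as a product over the vertices so that sums over
  -- all outcomes factorise.
  compatible : Exposed → Vec (Subset n) n → ℕ
  compatible E ω = product (λ v → 𝟙 (E v ⊆? lookup ω v))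

  extensions : Exposed → ℕ
  extensions E = total (compatible E) (outcomes G k)

  extensions≡ : ∀ E → extensions E ≡ product (λ v → supersets v (E v))
  extensions≡ E = total-productVec (choices G k) (λ v s → 𝟙 (E v ⊆? s))

  -- Only the factor at `u` changes, so this reduces to the count for the single vertex `u`.
  extensions-expose : ∀ E u j {a} → E u ⊆ neighbours G u → a ∈ neighbours G u ─ E u → k ≡ suc j + ∣ E u ∣ →
                      ∣ neighbours G u ─ E u ∣ * extensions (expose E u a) ≡ suc j * extensions E
  extensions-expose E u j {a} Eu⊆N a∈ k≡ with product-updateAt supersets E u
  ... | R , eq , eqs = begin
    D * extensions (expose E u a)             ≡⟨ cong (D *_) (trans (extensions≡ (expose E u a)) (eqs (_∪ ⁅ a ⁆))) ⟩
    D * (supersets u (E u ∪ ⁅ a ⁆) * R)       ≡⟨ *-assoc D _ R ⟨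
    D * supersets u (E u ∪ ⁅ a ⁆) * R         ≡⟨ cong (_* R) (supersets-∪⁅⁆ u (E u) j Eu⊆N a∈ k≡) ⟩
    suc j * supersets u (E u) * R             ≡⟨ *-assoc (suc j) (supersets u (E u)) R ⟩
    suc j * (supersets u (E u) * R)           ≡⟨ cong (suc j *_) (trans (extensions≡ E) eq) ⟨
    suc j * extensions E                      ∎
    where
    open ≡-Reasoning
    D = ∣ neighbours G u ─ E u ∣

  outcomes-valid : All (λ ω → ∀ v → lookup ω v ⊆ neighbours G v × ∣ lookup ω v ∣ ≡ k) (outcomes G k)
  outcomes-valid =
    productVec⁺ (λ v → all-filter (λ s → (s ⊆? neighbours G v) ×-dec (∣ s ∣ ≟ k)) (subsets n))

  module _ (b : Vec (Subset n) n → ℕ) where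

    -- When `b` is the indicator of an event, `mass E` over `extensions E` is its conditional
    -- probability given `E`.
    mass : Exposed → ℕ
    mass E = total (λ ω → compatible E ω * b ω) (outcomes G k)

    -- Double counting of pairs of an outcome and a next element: each outcome compatible with `E`
    -- has `j` unrevealed elements in its choice at `u`, and stays compatible when one of them is
    -- exposed.
    mass-expose : ∀ E u j → k ≡ j + ∣ E u ∣ →
                  j * mass E ≤ sum (λ a → 𝟙 (a ∈? neighbours G u ─ E u) * mass (expose E u a))
    mass-expose E u j k≡ = begin
      j * mass E                                                    ≡⟨ total-* j _ (outcomes G k) ⟨
      total (λ ω → j * (compatible E ω * b ω)) (outcomes G k)
        ≤⟨ total-mono-≤ (All.map (λ {ω} → pointwise ω) outcomes-valid) ⟩
      total (λ ω → sum (λ a → χ a * (compatible (expose E u a) ω * b ω))) (outcomes G k)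
        ≡⟨ total-∑ (λ a ω → χ a * (compatible (expose E u a) ω * b ω)) (outcomes G k) ⟩
      sum (λ a → total (λ ω → χ a * (compatible (expose E u a) ω * b ω)) (outcomes G k))
        ≡⟨ sum-cong-≗ (λ a → total-* (χ a) _ (outcomes G k)) ⟩
      sum (λ a → χ a * mass (expose E u a)) ∎
      where
      open ≤-Reasoning
      χ : Fin n → ℕ
      χ a = 𝟙 (a ∈? neighbours G u ─ E u)
      pointwise : ∀ ω → (∀ v → lookup ω v ⊆ neighbours G v × ∣ lookup ω v ∣ ≡ k) →
                  j * (compatible E ω * b ω) ≤ sum (λ a → χ a * (compatible (expose E u a) ω * b ω))
      pointwise ω valid with product-updateAt (λ v p → 𝟙 (p ⊆? lookup ω v)) E u
      ... | R , eq , eqs = begin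
        j * (compatible E ω * b ω)
          ≡⟨ cong (λ t → j * (t * b ω)) eq ⟩
        j * (𝟙 (E u ⊆? lookup ω u) * R * b ω)
          ≡⟨ assoc₁ j _ R (b ω) ⟩
        j * 𝟙 (E u ⊆? lookup ω u) * (R * b ω)
          ≤⟨ *-monoˡ-≤ (R * b ω) (∑∈─≥ (E u) _ (lookup ω u) j (proj₁ (valid u)) (trans (proj₂ (valid u)) k≡)) ⟩
        sum (λ a → χ a * 𝟙 (E u ∪ ⁅ a ⁆ ⊆? lookup ω u)) * (R * b ω)
          ≡⟨ *-distribʳ-sum (R * b ω) (λ a → χ a * 𝟙 (E u ∪ ⁅ a ⁆ ⊆? lookup ω u)) ⟩
        sum (λ a → χ a * 𝟙 (E u ∪ ⁅ a ⁆ ⊆? lookup ω u) * (R * b ω))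
          ≡⟨ sum-cong-≗ (λ a → trans (sym (assoc₁ (χ a) _ R (b ω)))
               (cong (λ t → χ a * (t * b ω)) (sym (eqs (_∪ ⁅ a ⁆))))) ⟩
        sum (λ a → χ a * (compatible (expose E u a) ω * b ω)) ∎
        where
        assoc₁ : ∀ x y z w → x * (y * z * w) ≡ x * y * (z * w)
        assoc₁ = solve-∀

    -- The law of total probability for the next element of the choice of u,
    -- which is uniform on the neighbours of u not yet exposed.
    mass-total : ∀ E u j K (w : Fin n → ℕ) → E u ⊆ neighbours G u → k ≡ suc j + ∣ E u ∣ →
      (∀ {a} → a ∈ neighbours G u ─ E u → mass (expose E u a) * K ≤ extensions (expose E u a) * w a) →
      mass E * K * ∣ neighbours G u ─ E u ∣ ≤
      extensions E * sum (λ a → 𝟙 (a ∈? neighbours G u ─ E u) * w a)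
    -- The factor `suc j` is the number of elements of the choice still unrevealed; it enters
    -- through `mass-expose` and leaves through `extensions-expose`.
    mass-total E u j K w Eu⊆N k≡ hyp = *-cancelˡ-≤ (suc j) (begin
      suc j * (mass E * K * D)
        ≡⟨ assoc₁ (suc j) (mass E) K D ⟩
      suc j * mass E * (K * D)
        ≤⟨ *-monoˡ-≤ (K * D) (mass-expose E u (suc j) k≡) ⟩
      sum (λ a → χ a * mass (expose E u a)) * (K * D)
        ≡⟨ *-distribʳ-sum (K * D) (λ a → χ a * mass (expose E u a)) ⟩
      sum (λ a → χ a * mass (expose E u a) * (K * D))
        ≤⟨ sum-mono-≤ pointwise ⟩
      sum (λ a → suc j * extensions E * (χ a * w a))
        ≡⟨ *-distribˡ-sum (suc j * extensions E) (λ a → χ a * w a) ⟨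
      suc j * extensions E * sum (λ a → χ a * w a)
        ≡⟨ *-assoc (suc j) (extensions E) _ ⟩
      suc j * (extensions E * sum (λ a → χ a * w a)) ∎)
      where
      open ≤-Reasoning
      D = ∣ neighbours G u ─ E u ∣
      χ : Fin n → ℕ
      χ a = 𝟙 (a ∈? neighbours G u ─ E u)
      assoc₁ : ∀ x y z w → x * (y * z * w) ≡ x * y * (z * w)
      assoc₁ = solve-∀
      assoc₂ : ∀ x y z → 1 * x * (y * z) ≡ x * y * z
      assoc₂ = solve-∀
      assoc₃ : ∀ x y z → x * y * z ≡ z * x * (1 * y)
      assoc₃ = solve-∀
      pointwise : ∀ a → χ a * mass (expose E u a) * (K * D) ≤ suc j * extensions E * (χ a * w a)
      pointwise a with a ∈? neighbours G u ─ E u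
      ... | no  _  = z≤n
      ... | yes a∈ = begin
        1 * mass (expose E u a) * (K * D)             ≡⟨ assoc₂ (mass (expose E u a)) K D ⟩
        mass (expose E u a) * K * D                   ≤⟨ *-monoˡ-≤ D (hyp a∈) ⟩
        extensions (expose E u a) * w a * D           ≡⟨ assoc₃ (extensions (expose E u a)) (w a) D ⟩
        D * extensions (expose E u a) * (1 * w a)     ≡⟨ cong (_* (1 * w a)) (extensions-expose E u j Eu⊆N a∈ k≡) ⟩
        suc j * extensions E * (1 * w a)              ∎

-- The depth-first search

-- The hit probability 1/q above is 1 / (q + 1) here, and b is the indicator of the
-- outcomes without a long path.
module Search
  {n} (G : Graph n) (k : ℕ) .{{_ : NonZero k}}
  (b : Vec (Subset n) n → ℕ) (b≤1 : ∀ ω → b ω ≤ 1) (ℓ s q : ℕ)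
  (b≡0 : ∀ ω r → ℓ ≤ r → Path (ChosenAdj ω) r → b ω ≡ 0)
  (degree≥ : ∀ v → suc q * (s + suc ℓ) ≤ q * degree G v)
  (s+1+ℓ≤n : s + suc ℓ ≤ n)
  where

  open Exposure G k

  -- `Q-1 / Q` is the factor 1 - 1 / (2 (q + 1)) gained per revelation: a hit has probability at
  -- least 1 / (q + 1) and halves the weight.
  Q Q-1 : ℕ
  Q-1 = 1 + 2 * q
  Q   = suc Q-1

  -- Counts the revelations at stack vertices only; those at dead vertices are accounted for by
  -- `k * σ`.
  exposed : ∀ {r} → Exposed → Vec (Fin n) r → ℕ
  exposed E U = Vec.sum (Vec.map (λ v → ∣ E v ∣) U)

  -- E is the part of the choices revealed so far, W the set of visited vertices,
  -- U the stack and σ the number of dead vertices.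
  record Invariant (E : Exposed) (W : Subset n) {r} (U : Vec (Fin n) r) (σ : ℕ) : Set where
    field
      unique  : Unique U
      linked  : Linked (λ x y → x ∈ E y) U
      visited : VecAll.All (_∈ W) U
      E⊆N     : ∀ v → E v ⊆ neighbours G v
      E⊆W     : ∀ v → E v ⊆ W
      fresh   : ∀ {v} → v ∉ W → ∣ E v ∣ ≡ 0
      ∣W∣≡    : ∣ W ∣ ≡ σ + r

  open Invariant

  expose-elim : ∀ (P : Fin n → Subset n → Set) E u a → P u (E u ∪ ⁅ a ⁆) → (∀ v → v ≢ u → P v (E v)) →
                ∀ v → P v (expose E u a v)
  expose-elim P E u a Pu P≢ v with v Fin.≟ u
  ... | yes refl = subst (P u) (sym (updateAt-updates u E)) Pu
  ... | no  v≢u  = subst (P v) (sym (updateAt-minimal v u E v≢u)) (P≢ v v≢u)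

  ⊆-expose : ∀ E u a v → E v ⊆ expose E u a v
  ⊆-expose E u a = expose-elim (λ v p → E v ⊆ p) E u a (p⊆p∪q ⁅ a ⁆) (λ v _ → id)

  ∣expose∣ : ∀ E u a → a ∉ E u → ∣ expose E u a u ∣ ≡ suc ∣ E u ∣
  ∣expose∣ E u a a∉ = trans (cong ∣_∣ (updateAt-updates u E)) (∣p∪⁅x⁆∣ (E u) a∉)

  exposed-expose : ∀ {r} E u a {U : Vec (Fin n) r} → VecAll.All (u ≢_) U →
                   exposed (expose E u a) U ≡ exposed E U
  exposed-expose E u a []          = refl
  exposed-expose E u a (u≢x ∷ u∉U) =
    cong₂ _+_ (cong ∣_∣ (updateAt-minimal _ u E (u≢x ∘ sym))) (exposed-expose E u a u∉U)

  -- Moves of the search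

  inv-start : ∀ {E W σ v} → Invariant E W [] σ → v ∉ W → Invariant E (W ∪ ⁅ v ⁆) (v ∷ []) σ
  inv-start {E} {W} {σ} {v} I v∉W = record
    { unique  = [] ∷ []
    ; linked  = [-]
    ; visited = x∈p∪⁅x⁆ W v ∷ []
    ; E⊆N     = E⊆N I
    ; E⊆W     = λ w x∈ → p⊆p∪q ⁅ v ⁆ (E⊆W I w x∈)
    ; fresh   = λ w∉ → fresh I (w∉ ∘ p⊆p∪q ⁅ v ⁆)
    ; ∣W∣≡    = trans (∣p∪⁅x⁆∣ W v∉W) (trans (cong suc (∣W∣≡ I)) (sym (+-suc σ 0)))
    }

  inv-pop : ∀ {E W σ r u} {U : Vec (Fin n) r} → Invariant E W (u ∷ U) σ → Invariant E W U (suc σ)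
  inv-pop {σ = σ} {r} I with unique I | visited I
  ... | _ ∷ uU | _ ∷ vU = record
    { unique  = uU
    ; linked  = Linked.tail (linked I)
    ; visited = vU
    ; E⊆N     = E⊆N I
    ; E⊆W     = E⊆W I
    ; fresh   = fresh I
    ; ∣W∣≡    = trans (∣W∣≡ I) (+-suc σ r)
    }

  inv-expose : ∀ {E W σ r u a} {U : Vec (Fin n) r} → Invariant E W (u ∷ U) σ →
               a ∈ neighbours G u → a ∈ W → Invariant (expose E u a) W (u ∷ U) σ
  inv-expose {E} {W} {u = u} {a} I a∈N a∈W = record
    { unique  = unique I
    ; linked  = Linked.map (λ {x} {y} → ⊆-expose E u a y) (linked I)
    ; visited = visited I
    ; E⊆N     = expose-elim (λ v p → p ⊆ neighbours G v) E u a (∪⁅⁆-⊆ (E⊆N I u) a∈N) (λ v _ → E⊆N I v)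
    ; E⊆W     = expose-elim (λ v p → p ⊆ W) E u a (∪⁅⁆-⊆ (E⊆W I u) a∈W) (λ v _ → E⊆W I v)
    ; fresh   = λ {v} v∉W → expose-elim (λ v p → v ∉ W → ∣ p ∣ ≡ 0) E u a
                  (λ u∉W → contradiction (VecAll.head (visited I)) u∉W) (λ v _ → fresh I) v v∉W
    ; ∣W∣≡    = ∣W∣≡ I
    }

  inv-hit : ∀ {E W σ r u a} {U : Vec (Fin n) r} → Invariant E W (u ∷ U) σ →
            a ∈ neighbours G u → a ∉ W → Invariant (expose E u a) (W ∪ ⁅ a ⁆) (a ∷ u ∷ U) σ
  inv-hit {E} {W} {σ} {r} {u} {a} {U} I a∈N a∉W = record
    { unique  = VecAll.map (λ { y∈W refl → a∉W y∈W }) (visited I) ∷ unique I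
    -- The head of the vector is the top of the stack, and each vertex was chosen by the one just
    -- below it; here `a` by `u`.
    ; linked  = subst (a ∈_) (sym (updateAt-updates u E)) (x∈p∪⁅x⁆ (E u) a) ∷
                Linked.map (λ {x} {y} → ⊆-expose E u a y) (linked I)
    ; visited = x∈p∪⁅x⁆ W a ∷ VecAll.map W⊆ (visited I)
    ; E⊆N     = expose-elim (λ v p → p ⊆ neighbours G v) E u a (∪⁅⁆-⊆ (E⊆N I u) a∈N) (λ v _ → E⊆N I v)
    ; E⊆W     = expose-elim (λ v p → p ⊆ W ∪ ⁅ a ⁆) E u a
                  (∪⁅⁆-⊆ (λ x∈ → W⊆ (E⊆W I u x∈)) (x∈p∪⁅x⁆ W a)) (λ v _ x∈ → W⊆ (E⊆W I v x∈))
    ; fresh   = λ {v} v∉ → expose-elim (λ v p → v ∉ W → ∣ p ∣ ≡ 0) E u a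
                  (λ u∉W → contradiction (VecAll.head (visited I)) u∉W) (λ v _ → fresh I) v (v∉ ∘ W⊆)
    ; ∣W∣≡    = trans (∣p∪⁅x⁆∣ W a∉W) (trans (cong suc (∣W∣≡ I)) (sym (+-suc σ (suc r))))
    }
    where
    W⊆ : W ⊆ W ∪ ⁅ a ⁆
    W⊆ = p⊆p∪q ⁅ a ⁆

  -- Bounding the probability of failure

  mass≤extensions : ∀ E → mass b E ≤ extensions E
  mass≤extensions E = total-mono-≤ (All.universal (λ ω →
    ≤-trans (*-monoʳ-≤ (compatible E ω) (b≤1 ω)) (≤-reflexive (*-identityʳ _))) (outcomes G k))

  -- An outcome either contradicts `E`, so that `compatible` vanishes, or contains every link of the
  -- stack, which is then a path with `r` edges and makes `b` vanish.
  mass≡0 : ∀ {E W σ r} {U : Vec (Fin n) (suc r)} → Invariant E W U σ → ℓ ≤ r → mass b E ≡ 0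
  mass≡0 {E} {r = r} {U} I ℓ≤r = total-zero pointwise (outcomes G k)
    where
    pointwise : ∀ ω → compatible E ω * b ω ≡ 0
    pointwise ω with any? (λ v → ¬? (E v ⊆? lookup ω v))
    ... | yes (v , ⊈) = cong (_* b ω) (product≡0 (λ v → 𝟙 (E v ⊆? lookup ω v)) v (𝟙-no (E v ⊆? lookup ω v) ⊈))
    ... | no  ¬∃      = trans (cong (compatible E ω *_) (b≡0 ω r ℓ≤r (U , unique I ,
      Linked.map (λ {x} {y} x∈ → inj₂ (decidable-stable (E y ⊆? lookup ω y) (λ ⊈ → ¬∃ (y , ⊈)) x∈)) (linked I))))
      (*-zeroʳ (compatible E ω))

  unvisited : ∀ W → ∣ W ∣ < n → ∃[ v ] v ∉ W
  unvisited W ∣W∣<n with any? (λ v → ¬? (v ∈? W))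
  ... | yes found = found
  ... | no  ¬∃    = contradiction ∣W∣<n (≤⇒≯ {n} {∣ W ∣} (≤-trans (≤-reflexive (sym (∣⊤∣≡n n)))
    (p⊆q⇒∣p∣≤∣q∣ {p = ⊤ {n}} {W} (λ {x} _ → decidable-stable (x ∈? W) (λ x∉ → ¬∃ (x , x∉))))))

  -- The weight of a hit is half the weight of a miss, and hits make up at
  -- least 1 / (q + 1) of the unexposed neighbours of u.
  exposure-weight : ∀ u (p W : Subset n) B → p ⊆ neighbours G u → p ⊆ W → ∣ W ∣ ≤ s + suc ℓ →
    (1 ≤ ∣ neighbours G u ─ p ∣) ×
    (sum (λ a → 𝟙 (a ∈? neighbours G u ─ p) * (suc (𝟙 (a ∈? W)) * B)) * Q ≤
     ∣ neighbours G u ─ p ∣ * (2 * Q-1 * B))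
  exposure-weight u p W B p⊆N p⊆W ∣W∣≤ = D≥1 , (begin
    sum (λ a → χ a * (suc (ν a) * B)) * Q
      ≡⟨ cong (_* Q) (sum-cong-≗ (λ a → rearrange (χ a) (ν a) B)) ⟩
    sum (λ a → (χ a + χ a * ν a) * B) * Q
      ≡⟨ cong (_* Q) (*-distribʳ-sum B (λ a → χ a + χ a * ν a)) ⟨
    sum (λ a → χ a + χ a * ν a) * B * Q
      ≡⟨ cong (λ t → t * B * Q) (trans (∑-distrib-+ χ (λ a → χ a * ν a)) (cong (_+ X) (sym (∣p∣≡∑ (N ─ p))))) ⟩
    (D + X) * B * Q
      ≡⟨ rearrange₂ (D + X) B Q ⟩
    (D + X) * Q * B
      ≤⟨ *-monoˡ-≤ B main ⟩
    D * (2 * Q-1) * B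
      ≡⟨ *-assoc D (2 * Q-1) B ⟩
    D * (2 * Q-1 * B) ∎)
    where
    open ≤-Reasoning
    N = neighbours G u
    d = degree G u
    D = ∣ N ─ p ∣
    χ ν : Fin n → ℕ
    χ a = 𝟙 (a ∈? N ─ p)
    ν a = 𝟙 (a ∈? W)
    -- Among the unexposed neighbours of `u`, `X` counts the misses (already visited) and `H` the
    -- hits.
    X = sum (λ a → χ a * ν a)
    H = sum (λ a → χ a * 𝟙 (¬? (a ∈? W)))
    rearrange : ∀ x y z → x * ((1 + y) * z) ≡ (x + x * y) * z
    rearrange = solve-∀
    rearrange₂ : ∀ x y z → x * y * z ≡ x * z * y
    rearrange₂ = solve-∀
    D≡H+X : D ≡ H + X
    D≡H+X = trans (∣p∣≡∑ (N ─ p)) (trans (sum-cong-≗ split) (∑-distrib-+ (λ a → χ a * 𝟙 (¬? (a ∈? W))) _))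
      where
      split : ∀ a → χ a ≡ χ a * 𝟙 (¬? (a ∈? W)) + χ a * ν a
      split a with a ∈? W
      ... | yes _ = sym (trans (cong₂ _+_ (*-zeroʳ (χ a)) (*-identityʳ (χ a))) refl)
      ... | no  _ = sym (trans (cong₂ _+_ (*-identityʳ (χ a)) (*-zeroʳ (χ a))) (+-identityʳ (χ a)))
    d≤H+∣W∣ : d ≤ H + ∣ W ∣
    d≤H+∣W∣ = begin
      ∣ N ∣                    ≡⟨ ∣p∣≡∑ N ⟩
      sum (λ a → 𝟙 (a ∈? N))   ≤⟨ sum-mono-≤ pointwise ⟩
      sum (λ a → χ a * 𝟙 (¬? (a ∈? W)) + ν a)  ≡⟨ ∑-distrib-+ (λ a → χ a * 𝟙 (¬? (a ∈? W))) ν ⟩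
      H + sum ν                ≡⟨ cong (H +_) (∣p∣≡∑ W) ⟨
      H + ∣ W ∣                ∎
      where
      pointwise : ∀ a → 𝟙 (a ∈? N) ≤ χ a * 𝟙 (¬? (a ∈? W)) + ν a
      pointwise a with a ∈? N | a ∈? W
      ... | no _    | _       = z≤n
      ... | yes _   | yes _   = m≤n+m 1 _
      -- Exposed elements are visited, so an unvisited neighbour of `u` is still unexposed and
      -- counts as a hit.
      ... | yes a∈N | no  a∉W = ≤-reflexive (sym (trans (+-identityʳ _) (trans (*-identityʳ (χ a))
        (𝟙-yes (a ∈? N ─ p) (x∈p∧x∉q⇒x∈p─q a∈N (a∉W ∘ p⊆W))))))
    -- By `degree≥` the visited set covers at most the fraction q / (q + 1) of the neighbourhood, so
    -- hits make up the rest.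
    d≤qH : d ≤ suc q * H
    d≤qH = +-cancelʳ-≤ (q * d) _ _ (begin
      suc q * d                    ≤⟨ *-monoʳ-≤ (suc q) d≤H+∣W∣ ⟩
      suc q * (H + ∣ W ∣)          ≡⟨ *-distribˡ-+ (suc q) H ∣ W ∣ ⟩
      suc q * H + suc q * ∣ W ∣    ≤⟨ +-monoʳ-≤ (suc q * H) (≤-trans (*-monoʳ-≤ (suc q) ∣W∣≤) (degree≥ u)) ⟩
      suc q * H + q * d            ∎)
    D≤qH : D ≤ suc q * H
    D≤qH = ≤-trans (∣p─q∣≤∣p∣ N (p)) d≤qH
    H≥1 : 1 ≤ H
    H≥1 = n≢0⇒n>0 λ H≡0 → contradiction (begin
      1                      ≤⟨ m≤n+m 1 (s + ℓ) ⟩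
      s + ℓ + 1              ≡⟨ trans (+-assoc s ℓ 1) (cong (s +_) (+-comm ℓ 1)) ⟩
      s + suc ℓ              ≤⟨ m≤m+n (s + suc ℓ) (q * (s + suc ℓ)) ⟩
      suc q * (s + suc ℓ)    ≤⟨ degree≥ u ⟩
      q * d                  ≤⟨ *-monoʳ-≤ q d≤qH ⟩
      q * (suc q * H)        ≡⟨ cong (λ h → q * (suc q * h)) H≡0 ⟩
      q * (suc q * 0)        ≡⟨ trans (cong (q *_) (*-zeroʳ (suc q))) (*-zeroʳ q) ⟩
      0                      ∎) λ ()
    D≥1 : 1 ≤ D
    D≥1 = ≤-trans H≥1 (≤-trans (m≤m+n H X) (≤-reflexive (sym D≡H+X)))
    -- A hit weighs 1 and a miss 2, for a total of `D + X`. Adding `2 * D` to both sides avoids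
    -- subtraction and reduces the claim to `D≤qH`.
    main : (D + X) * Q ≤ D * (2 * Q-1)
    main = +-cancelʳ-≤ (2 * D) _ _ (begin
      (D + X) * Q + 2 * D                        ≡⟨ expand₁ D X q ⟩
      2 * (suc q * D) + 2 * (suc q * X + D)      ≤⟨ +-monoʳ-≤ (2 * (suc q * D)) (*-monoʳ-≤ 2 (+-monoʳ-≤ (suc q * X) D≤qH)) ⟩
      2 * (suc q * D) + 2 * (suc q * X + suc q * H)
        ≡⟨ cong (λ t → 2 * (suc q * D) + 2 * t)
             (trans (sym (*-distribˡ-+ (suc q) X H)) (cong (suc q *_) (trans (+-comm X H) (sym D≡H+X)))) ⟩
      2 * (suc q * D) + 2 * (suc q * D)          ≡⟨ expand₂ D q ⟩
      D * (2 * Q-1) + 2 * D                      ∎)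
      where
      expand₁ : ∀ D X q → (D + X) * (1 + (1 + 2 * q)) + 2 * D ≡ 2 * ((1 + q) * D) + 2 * ((1 + q) * X + D)
      expand₁ = solve-∀
      expand₂ : ∀ D q → 2 * ((1 + q) * D) + 2 * ((1 + q) * D) ≡ D * (2 * (1 + 2 * q)) + 2 * D
      expand₂ = solve-∀

  -- τ revelations and g visits are left before the search stops.
  Bounded : ∀ τ g {r} → Vec (Fin n) r → Set
  Bounded τ g U = ∀ {E W σ} → Invariant E W U σ →
    ∣ W ∣ + g ≡ s + suc ℓ → k * σ + exposed E U + τ ≤ k * s →
    mass b E * Q ^ τ ≤ extensions E * (2 ^ g * Q-1 ^ τ)

  -- One revelation at the top `u`: a miss keeps `g`, a hit lowers it by one and pushes the new
  -- vertex. The law of total probability averages the two bounds, and `exposure-weight` compares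
  -- the average with the claim.
  bounded-expose : ∀ {τ} g {r} u (U : Vec (Fin n) r) → (∀ g {r} (U : Vec (Fin n) r) → Bounded τ g U) →
    ∀ {E W σ} → Invariant E W (u ∷ U) σ → ∣ E u ∣ < k →
    ∣ W ∣ + suc g ≡ s + suc ℓ → k * σ + exposed E (u ∷ U) + suc τ ≤ k * s →
    mass b E * Q ^ suc τ ≤ extensions E * (2 ^ suc g * Q-1 ^ suc τ)
  bounded-expose {τ} g u U IH {E} {W} {σ} I ∣Eu∣<k g≡ τ≤ = *-cancelʳ-≤ _ _ D {{ℕ.>-nonZero (proj₁ ew)}} (begin
    mass b E * (Q * Q ^ τ) * D                 ≡⟨ rearrange₁ (mass b E) Q (Q ^ τ) D ⟩
    mass b E * Q ^ τ * D * Q                   ≤⟨ *-monoˡ-≤ Q (mass-total b E u j (Q ^ τ) w (E⊆N I u) k≡ step) ⟩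
    extensions E * sum (λ a → χ a * w a) * Q   ≡⟨ *-assoc (extensions E) _ Q ⟩
    extensions E * (sum (λ a → χ a * w a) * Q) ≤⟨ *-monoʳ-≤ (extensions E) (proj₂ ew) ⟩
    extensions E * (D * (2 * Q-1 * B))         ≡⟨ rearrange₂ (extensions E) D Q-1 (2 ^ g) (Q-1 ^ τ) ⟩
    extensions E * (2 * 2 ^ g * (Q-1 * Q-1 ^ τ)) * D ∎)
    where
    open ≤-Reasoning
    N = neighbours G u
    D = ∣ N ─ E u ∣
    χ : Fin n → ℕ
    χ a = 𝟙 (a ∈? N ─ E u)
    B = 2 ^ g * Q-1 ^ τ
    w : Fin n → ℕ
    w a = suc (𝟙 (a ∈? W)) * B
    j = k ℕ.∸ suc ∣ E u ∣
    k≡ : k ≡ suc j + ∣ E u ∣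
    k≡ = trans (sym (m∸n+n≡m ∣Eu∣<k)) (+-suc j ∣ E u ∣)
    ew = exposure-weight u (E u) W B (E⊆N I u) (E⊆W I u) (≤-trans (m≤m+n ∣ W ∣ (suc g)) (≤-reflexive g≡))
    rearrange₁ : ∀ x y z t → x * (y * z) * t ≡ x * z * t * y
    rearrange₁ = solve-∀
    rearrange₂ : ∀ x d y z t → x * (d * (2 * y * (z * t))) ≡ x * (2 * z * (y * t)) * d
    rearrange₂ = solve-∀
    shift : ∀ x y z → x + (1 + y) + z ≡ x + y + (1 + z)
    shift = solve-∀
    -- The revelation moves one unit from `τ` to `exposed`; `u` occurs only once on the stack, so it
    -- is counted once.
    budget : ∀ {a} → a ∈ N ─ E u → k * σ + exposed (expose E u a) (u ∷ U) + τ ≤ k * s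
    budget {a} a∈ with unique I
    ... | u∉U ∷ _ = ≤-trans (≤-reflexive (trans
      (cong (λ t → k * σ + t + τ)
        (cong₂ _+_ (∣expose∣ E u a (x∈p─q⇒x∉q N (E u) a∈)) (exposed-expose E u a u∉U)))
      (shift (k * σ) (∣ E u ∣ + exposed E U) τ))) τ≤
    step : ∀ {a} → a ∈ N ─ E u → mass b (expose E u a) * Q ^ τ ≤ extensions (expose E u a) * w a
    step {a} a∈ with a ∈? W
    ... | yes a∈W = ≤-trans (IH (suc g) (u ∷ U) (inv-expose I (p─q⊆p N (E u) a∈) a∈W) g≡ (budget a∈))
      (≤-reflexive (cong (extensions (expose E u a) *_) (*-assoc 2 (2 ^ g) (Q-1 ^ τ))))
    ... | no  a∉W = ≤-trans (IH g (a ∷ u ∷ U) (inv-hit I (p─q⊆p N (E u) a∈) a∉W)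
        (trans (cong (_+ g) (∣p∪⁅x⁆∣ W a∉W)) (trans (sym (+-suc ∣ W ∣ g)) g≡))
        (≤-trans (≤-reflexive (cong (λ t → k * σ + (t + exposed (expose E u a) (u ∷ U)) + τ) ∣Ea∣≡0)) (budget a∈)))
      (≤-reflexive (cong (extensions (expose E u a) *_) (sym (+-identityʳ B))))
      where
      -- A newly pushed vertex has revealed nothing and so leaves the budget unchanged.
      a≢u : a ≢ u
      a≢u refl = a∉W (VecAll.head (visited I))
      ∣Ea∣≡0 : ∣ expose E u a a ∣ ≡ 0
      ∣Ea∣≡0 = trans (cong ∣_∣ (updateAt-minimal a u E a≢u)) (fresh I a∉W)

  -- An empty stack is restarted at an unvisited vertex, an unfinished top reveals an element, and a
  -- finished top is popped. Popping changes neither `τ` nor `g`, so that case recurses on the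
  -- stack.
  bounded-step : ∀ {τ g} → (∀ g {r} (U : Vec (Fin n) r) → Bounded τ g U) →
                 (∀ {r} (U : Vec (Fin n) r) → Bounded (suc τ) g U) →
                 ∀ {r} (U : Vec (Fin n) r) → Bounded (suc τ) (suc g) U
  bounded-step {τ} {g} IHτ IHg [] {E} {W} {σ} I g≡ τ≤ with unvisited W (begin-strict
      ∣ W ∣           <⟨ m<m+n ∣ W ∣ (s≤s z≤n) ⟩
      ∣ W ∣ + suc g   ≡⟨ g≡ ⟩
      s + suc ℓ       ≤⟨ s+1+ℓ≤n ⟩
      n               ∎)
    where open ≤-Reasoning
  -- A restart visits a vertex without a revelation, so `g` drops for free and the bound obtained is
  -- twice as good as required.
  ... | v , v∉W = ≤-trans
    (IHg (v ∷ []) (inv-start I v∉W)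
      (trans (cong (_+ g) (∣p∪⁅x⁆∣ W v∉W)) (trans (sym (+-suc ∣ W ∣ g)) g≡))
      (≤-trans (≤-reflexive (cong (λ t → k * σ + (t + 0) + suc τ) (fresh I v∉W))) τ≤))
    (*-monoʳ-≤ (extensions E) (*-monoˡ-≤ (Q-1 ^ suc τ) (m≤m+n (2 ^ g) _)))
  bounded-step {τ} {g} IHτ IHg (u ∷ U) {E} {W} {σ} I g≡ τ≤ with suc ∣ E u ∣ ≤? k
  ... | yes ∣Eu∣<k = bounded-expose g u U IHτ I ∣Eu∣<k g≡ τ≤
  -- The at least `k` revelations at `u` pay for the growth of `k * σ` when `u` dies.
  ... | no  ∣Eu∣≮k = bounded-step IHτ IHg U (inv-pop I) g≡ (≤-trans (+-monoˡ-≤ (suc τ) (begin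
    k * suc σ + exposed E U            ≡⟨ rearrange k σ (exposed E U) ⟩
    k * σ + (k + exposed E U)          ≤⟨ +-monoʳ-≤ (k * σ) (+-monoˡ-≤ (exposed E U) (s≤s⁻¹ (≰⇒> ∣Eu∣≮k))) ⟩
    k * σ + (∣ E u ∣ + exposed E U)    ∎)) τ≤)
    where
    open ≤-Reasoning
    rearrange : ∀ k σ x → k * (1 + σ) + x ≡ k * σ + (k + x)
    rearrange = solve-∀

  -- All `s + suc ℓ` visits have been made, while the budget allows at most `s` dead vertices. The
  -- stack thus has more than `ℓ` vertices and the mass is 0.
  bounded-exhausted : ∀ τ {r} (U : Vec (Fin n) r) → Bounded τ 0 U
  bounded-exhausted τ {r} U {E} {W} {σ} I g≡ τ≤ with r ≤? ℓ
  bounded-exhausted τ {zero} U I g≡ τ≤ | no r≰ℓ = contradiction z≤n r≰ℓ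
  bounded-exhausted τ {suc r} U I g≡ τ≤ | no r≰ℓ =
    ≤-trans (≤-reflexive (cong (_* Q ^ τ) (mass≡0 I (s≤s⁻¹ (≰⇒> r≰ℓ))))) z≤n
  bounded-exhausted τ {r} U {E} {W} {σ} I g≡ τ≤ | yes r≤ℓ = contradiction (begin
    s + suc ℓ     ≡⟨ g≡ ⟨
    ∣ W ∣ + 0     ≡⟨ +-identityʳ ∣ W ∣ ⟩
    ∣ W ∣         ≡⟨ ∣W∣≡ I ⟩
    σ + r         ≤⟨ +-mono-≤ σ≤s r≤ℓ ⟩
    s + ℓ         ∎) (<⇒≱ (≤-reflexive (sym (+-suc s ℓ))))
    where
    open ≤-Reasoning
    σ≤s : σ ≤ s
    σ≤s = *-cancelˡ-≤ k (≤-trans (≤-trans (m≤m+n (k * σ) (exposed E U)) (m≤m+n _ τ)) τ≤)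

  bounded : ∀ τ g {r} (U : Vec (Fin n) r) → Bounded τ g U
  bounded τ       zero    U = bounded-exhausted τ U
  bounded (suc τ) (suc g) U = bounded-step (bounded τ) (bounded (suc τ) g) U
  -- With no revelations left the weight is a power of 2, and the trivial bound 1 on the probability
  -- suffices.
  bounded zero    (suc g) U {E} I g≡ τ≤ =
    *-mono-≤ (mass≤extensions E) (*-mono-≤ {1} (m^n>0 2 (suc g)) ≤-refl)

  total-bounded : total b (outcomes G k) * Q ^ (k * s) ≤
                  length (outcomes G k) * (2 ^ (s + suc ℓ) * Q-1 ^ (k * s))
  total-bounded = subst₂ (λ x y → x * Q ^ (k * s) ≤ y * (2 ^ (s + suc ℓ) * Q-1 ^ (k * s)))
    (total-cong (λ ω → trans (cong (_* b ω) (compatible-⊥ ω)) (+-identityʳ (b ω))) (outcomes G k))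
    (trans (total-cong compatible-⊥ (outcomes G k)) (total-one (outcomes G k)))
    (bounded (k * s) (s + suc ℓ) [] start (cong (_+ (s + suc ℓ)) (∣⊥∣≡0 n))
      (≤-reflexive (cong (λ t → t + 0 + k * s) (*-zeroʳ k))))
    where
    compatible-⊥ : ∀ ω → compatible (λ _ → ⊥) ω ≡ 1
    compatible-⊥ ω = product≡1 (λ v → 𝟙 (⊥ ⊆? lookup ω v)) (λ v → 𝟙-yes (⊥ ⊆? lookup ω v) ⊥⊆)
    start : Invariant (λ _ → ⊥) ⊥ [] 0
    start = record
      { unique  = []
      ; linked  = []
      ; visited = []
      ; E⊆N     = λ v → ⊥⊆
      ; E⊆W     = λ v → ⊥⊆
      ; fresh   = λ _ → ∣⊥∣≡0 n
      ; ∣W∣≡    = ∣⊥∣≡0 n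
      }

-- Rational arithmetic

fromℚᵘ-homo-+ : ∀ p q → fromℚᵘ (p ℚᵘ.+ q) ≡ fromℚᵘ p ℚ.+ fromℚᵘ q
fromℚᵘ-homo-+ p q = ℚ.toℚᵘ-injective (begin
  toℚᵘ (fromℚᵘ (p ℚᵘ.+ q))                ≈⟨ ℚ.toℚᵘ-fromℚᵘ (p ℚᵘ.+ q) ⟩
  p ℚᵘ.+ q                                ≈⟨ ℚᵘ.+-cong (ℚ.toℚᵘ-fromℚᵘ p) (ℚ.toℚᵘ-fromℚᵘ q) ⟨
  toℚᵘ (fromℚᵘ p) ℚᵘ.+ toℚᵘ (fromℚᵘ q)    ≈⟨ ℚ.toℚᵘ-homo-+ (fromℚᵘ p) (fromℚᵘ q) ⟨
  toℚᵘ (fromℚᵘ p ℚ.+ fromℚᵘ q)            ∎)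
  where open ℚᵘ.≃-Reasoning

fromℕ-homo-+ : ∀ m n → fromℕ (m ℕ.+ n) ≡ fromℕ m ℚ.+ fromℕ n
fromℕ-homo-+ m n = trans
  (ℚ.fromℚᵘ-cong {mkℚᵘ (ℤ.+ (m ℕ.+ n)) 0} {mkℚᵘ (ℤ.+ m) 0 ℚᵘ.+ mkℚᵘ (ℤ.+ n) 0}
    (*≡* (cong (ℤ._* ℤ.+ 1) (trans (ℤ.pos-+ m n) (sym (cong₂ ℤ._+_ (ℤ.*-identityʳ (ℤ.+ m)) (ℤ.*-identityʳ (ℤ.+ n))))))))
  (fromℚᵘ-homo-+ (mkℚᵘ (ℤ.+ m) 0) (mkℚᵘ (ℤ.+ n) 0))

fromℕ-mono-≤ : ∀ {m n} → m ℕ.≤ n → fromℕ m ℚ.≤ fromℕ n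
fromℕ-mono-≤ {m} {n} m≤n = ℚ.toℚᵘ-cancel-≤ (begin
  toℚᵘ (fromℕ m)  ≃⟨ ℚ.toℚᵘ-fromℚᵘ (mkℚᵘ (ℤ.+ m) 0) ⟩
  mkℚᵘ (ℤ.+ m) 0    ≤⟨ *≤* (ℤ.*-monoʳ-≤-nonNeg (ℤ.+ 1) (+≤+ m≤n)) ⟩
  mkℚᵘ (ℤ.+ n) 0    ≃⟨ ℚ.toℚᵘ-fromℚᵘ (mkℚᵘ (ℤ.+ n) 0) ⟨
  toℚᵘ (fromℕ n)  ∎)
  where open ℚᵘ.≤-Reasoning

-- A positive rational has numerator at least 1, so `ε` is at least `1 / ↧ₙ ε`.
fromℕ≤*fromℕ : ∀ ε x m → 0ℚ ℚ.< ε → x ℕ.* ↧ₙ ε ℕ.≤ m → fromℕ x ℚ.≤ ε ℚ.* fromℕ m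
fromℕ≤*fromℕ (mkℚ (ℤ.+ zero) b c) x m (*<* (+<+ ())) x*b≤m
fromℕ≤*fromℕ ε@(mkℚ (ℤ.+ suc a) b c) x m 0<ε x*b≤m = ℚ.toℚᵘ-cancel-≤ (begin
  toℚᵘ (fromℕ x)              ≃⟨ ℚ.toℚᵘ-fromℚᵘ (mkℚᵘ (ℤ.+ x) 0) ⟩
  mkℚᵘ (ℤ.+ x) 0                ≤⟨ *≤* (subst₂ ℤ._≤_ (ℤ.pos-* x (suc b ℕ.* 1))
    (trans (ℤ.pos-* (suc a ℕ.* m) 1) (cong (ℤ._* ℤ.+ 1) (ℤ.pos-* (suc a) m))) (+≤+ x*b≤a*m)) ⟩
  toℚᵘ ε ℚᵘ.* mkℚᵘ (ℤ.+ m) 0    ≃⟨ ℚᵘ.*-congˡ {toℚᵘ ε} (ℚ.toℚᵘ-fromℚᵘ (mkℚᵘ (ℤ.+ m) 0)) ⟨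
  toℚᵘ ε ℚᵘ.* toℚᵘ (fromℕ m)  ≃⟨ ℚ.toℚᵘ-homo-* ε (fromℕ m) ⟨
  toℚᵘ (ε ℚ.* fromℕ m)        ∎)
  where
  open ℚᵘ.≤-Reasoning
  x*b≤a*m : x ℕ.* (suc b ℕ.* 1) ℕ.≤ suc a ℕ.* m ℕ.* 1
  x*b≤a*m = subst₂ ℕ._≤_ (cong (x ℕ.*_) (sym (ℕ.*-identityʳ (suc b)))) (sym (ℕ.*-identityʳ (suc a ℕ.* m)))
    (ℕ.≤-trans x*b≤m (ℕ.m≤m+n m (a ℕ.* m)))

[1-ε]*m≤ : ∀ ε ℓ x → 0ℚ ℚ.< ε → x ℕ.* ↧ₙ ε ℕ.≤ ℓ ℕ.+ x → (1ℚ ℚ.- ε) ℚ.* fromℕ (ℓ ℕ.+ x) ℚ.≤ fromℕ ℓ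
[1-ε]*m≤ ε ℓ x 0<ε x*b≤ = begin
  (1ℚ ℚ.- ε) ℚ.* M             ≡⟨ ℚ.*-distribʳ-+ M 1ℚ (ℚ.- ε) ⟩
  1ℚ ℚ.* M ℚ.+ (ℚ.- ε) ℚ.* M   ≡⟨ cong₂ ℚ._+_ (ℚ.*-identityˡ M) (sym (ℚ.neg-distribˡ-* ε M)) ⟩
  M ℚ.- ε ℚ.* M                ≤⟨ ℚ.+-monoʳ-≤ M (ℚ.neg-antimono-≤ (fromℕ≤*fromℕ ε x (ℓ ℕ.+ x) 0<ε x*b≤)) ⟩
  M ℚ.- fromℕ x                ≡⟨ cong (ℚ._- fromℕ x) (fromℕ-homo-+ ℓ x) ⟩
  fromℕ ℓ ℚ.+ fromℕ x ℚ.- fromℕ x   ≡⟨ ℚ.+-assoc (fromℕ ℓ) (fromℕ x) (ℚ.- fromℕ x) ⟩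
  fromℕ ℓ ℚ.+ (fromℕ x ℚ.- fromℕ x) ≡⟨ cong (fromℕ ℓ ℚ.+_) (ℚ.+-inverseʳ (fromℕ x)) ⟩
  fromℕ ℓ ℚ.+ 0ℚ               ≡⟨ ℚ.+-identityʳ (fromℕ ℓ) ⟩
  fromℕ ℓ                      ∎
  where
  open ℚ.≤-Reasoning
  M = fromℕ (ℓ ℕ.+ x)

-- The distance to 1 is `bad / N`, which is below `1 / ↧ₙ δ` and hence below `δ`.
∣ratio-1∣<δ : ∀ δ good bad N → 0ℚ ℚ.< δ → good ℕ.+ bad ≡ N → bad ℕ.* ↧ₙ δ ℕ.< N →
              ℚ.∣ ratio good N ℚ.- 1ℚ ∣ ℚ.< δ
∣ratio-1∣<δ (mkℚ (ℤ.+ zero) b c) good bad (suc N) (*<* (+<+ ())) g+b≡ b<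
∣ratio-1∣<δ δ@(mkℚ (ℤ.+ suc a) b c) good bad (suc N) 0<δ g+b≡ b< = begin-strict
  ℚ.∣ x ℚ.- 1ℚ ∣       ≡⟨ cong (λ t → ℚ.∣ x ℚ.- t ∣) (sym x+y≡1) ⟩
  ℚ.∣ x ℚ.- (x ℚ.+ y) ∣ ≡⟨ cong ℚ.∣_∣ x-[x+y] ⟩
  ℚ.∣ ℚ.- y ∣          ≡⟨ ℚ.∣-p∣≡∣p∣ y ⟩
  ℚ.∣ y ∣              ≡⟨ ℚ.0≤p⇒∣p∣≡p 0≤y ⟩
  y                    <⟨ y<δ ⟩
  δ                    ∎
  where
  open ℚ.≤-Reasoning
  x y : ℚ
  x = ratio good (suc N)
  y = ratio bad (suc N)
  x-[x+y] : x ℚ.- (x ℚ.+ y) ≡ ℚ.- y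
  x-[x+y] = begin-equality
    x ℚ.- (x ℚ.+ y)             ≡⟨ cong (x ℚ.+_) (ℚ.neg-distrib-+ x y) ⟩
    x ℚ.+ (ℚ.- x ℚ.- y)         ≡⟨ ℚ.+-assoc x (ℚ.- x) (ℚ.- y) ⟨
    x ℚ.- x ℚ.- y               ≡⟨ cong (ℚ._- y) (ℚ.+-inverseʳ x) ⟩
    0ℚ ℚ.- y                    ≡⟨ ℚ.+-identityˡ (ℚ.- y) ⟩
    ℚ.- y                       ∎
  x+y≡1 : x ℚ.+ y ≡ 1ℚ
  x+y≡1 = trans (sym (fromℚᵘ-homo-+ (mkℚᵘ (ℤ.+ good) N) (mkℚᵘ (ℤ.+ bad) N)))
    (ℚ.fromℚᵘ-cong {mkℚᵘ (ℤ.+ good) N ℚᵘ.+ mkℚᵘ (ℤ.+ bad) N} {mkℚᵘ (ℤ.+ 1) 0} (*≡* numerators))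
    where
    numerators : (ℤ.+ good ℤ.* ℤ.+ suc N ℤ.+ ℤ.+ bad ℤ.* ℤ.+ suc N) ℤ.* ℤ.+ 1 ≡ ℤ.+ 1 ℤ.* (ℤ.+ suc N ℤ.* ℤ.+ suc N)
    numerators = trans (ℤ.*-identityʳ _) (trans (sym (ℤ.*-distribʳ-+ (ℤ.+ suc N) (ℤ.+ good) (ℤ.+ bad)))
      (trans (cong (λ t → t ℤ.* ℤ.+ suc N) (trans (sym (ℤ.pos-+ good bad)) (cong ℤ.+_ g+b≡))) (sym (ℤ.*-identityˡ _))))
  0≤y : 0ℚ ℚ.≤ y
  0≤y = ℚ.toℚᵘ-cancel-≤ (ℚᵘ.≤-respʳ-≃ (ℚᵘ.≃-sym (ℚ.toℚᵘ-fromℚᵘ (mkℚᵘ (ℤ.+ bad) N)))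
    (*≤* (subst (ℤ.+ 0 ℤ.≤_) (sym (ℤ.*-identityʳ (ℤ.+ bad))) (+≤+ z≤n))))
  y<δ : y ℚ.< δ
  y<δ = ℚ.toℚᵘ-cancel-< (ℚᵘ.<-respˡ-≃ (ℚᵘ.≃-sym (ℚ.toℚᵘ-fromℚᵘ (mkℚᵘ (ℤ.+ bad) N)))
    (*<* (subst₂ ℤ._<_ (ℤ.pos-* bad (suc b)) (ℤ.pos-* (suc a) (suc N))
      (+<+ (ℕ.<-≤-trans b< (ℕ.m≤m+n (suc N) (a ℕ.* suc N)))))))

-- The choice of constants

k≤n⇒nCk>0 : ∀ {n k} → k ≤ n → 1 ≤ n C k
k≤n⇒nCk>0 {n} {zero} k≤n = ≤-refl
k≤n⇒nCk>0 {suc n} {suc k} (s≤s k≤n) = ≤-trans (k≤n⇒nCk>0 k≤n)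
  (≤-trans (m≤m+n (n C k) (n C suc k)) (≤-reflexive (nCk+nC[k+1]≡[n+1]C[k+1] n k)))

-- The number of outcomes is a product of binomial coefficients, each positive because `k` does not
-- exceed any degree.
length-outcomes>0 : ∀ {n} (G : Graph n) k → (∀ v → k ≤ degree G v) → 0 < length (outcomes G k)
length-outcomes>0 {n} G k k≤d = ≤-trans
  (product-pos (λ v → supersets v ⊥) λ v → ≤-trans (k≤n⇒nCk>0 (k≤d v))
    (≤-reflexive (sym (supersets≡ v ⊥ k (degree G v) ⊥⊆ (+∣⊥∣ (degree G v)) (+∣⊥∣ k)))))
  (≤-reflexive (trans (sym (extensions≡ (λ _ → ⊥)))
    (trans (total-cong (λ ω → product≡1 _ (λ v → 𝟙-yes (⊥ ⊆? lookup ω v) ⊥⊆)) (outcomes G k))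
      (total-one (outcomes G k)))))
  where
  open Exposure G k
  +∣⊥∣ : ∀ x → x ≡ x + ∣ ⊥ {n} ∣
  +∣⊥∣ x = sym (trans (cong (x +_) (∣⊥∣≡0 n)) (+-identityʳ x))

-- Exponential estimates

n<2^n : ∀ n → n < 2 ^ n
n<2^n zero    = ≤-refl
n<2^n (suc n) = +-mono-≤ (m^n>0 2 n) (≤-trans (n<2^n n) (m≤m+n (2 ^ n) 0))

^-distribʳ-* : ∀ m n o → (m * n) ^ o ≡ m ^ o * n ^ o
^-distribʳ-* m n zero    = refl
^-distribʳ-* m n (suc o) = trans (cong (m * n *_) (^-distribʳ-* m n o)) (swap m n (m ^ o) (n ^ o))
  where
  swap : ∀ a b c d → a * b * (c * d) ≡ a * c * (b * d)
  swap = solve-∀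

-- Bernoulli's inequality for (1 + 1 / x) ^ n, multiplied by x ^ (n + 1).
bernoulli : ∀ x n → x ^ n * (x + n) ≤ x * suc x ^ n
bernoulli x zero    = ≤-reflexive (trans (+-identityʳ (x + 0)) (trans (+-identityʳ x) (sym (*-identityʳ x))))
bernoulli x (suc n) = begin
  x * x ^ n * (x + suc n)        ≤⟨ m≤m+n _ (x ^ n * n) ⟩
  x * x ^ n * (x + suc n) + x ^ n * n  ≡⟨ expand x (x ^ n) n ⟩
  x ^ n * (x + n) * suc x        ≤⟨ *-monoˡ-≤ (suc x) (bernoulli x n) ⟩
  x * suc x ^ n * suc x          ≡⟨ trans (*-assoc x (suc x ^ n) (suc x)) (cong (x *_) (*-comm (suc x ^ n) (suc x))) ⟩
  x * suc x ^ suc n              ∎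
  where
  open ≤-Reasoning
  expand : ∀ x y n → x * y * (x + (1 + n)) + y * n ≡ y * (x + n) * (1 + x)
  expand = solve-∀

2*x^x≤[1+x]^x : ∀ x .{{_ : NonZero x}} → 2 * x ^ x ≤ suc x ^ x
2*x^x≤[1+x]^x x = *-cancelˡ-≤ x (begin
  x * (2 * x ^ x)   ≡⟨ expand x (x ^ x) ⟩
  x ^ x * (x + x)   ≤⟨ bernoulli x x ⟩
  x * suc x ^ x     ∎)
  where
  open ≤-Reasoning
  expand : ∀ x y → x * (2 * y) ≡ y * (x + x)
  expand = solve-∀

-- Each of `c` blocks of `x` factors 1 + 1 / x contributes at least 2, and the remaining `e` factors
-- at least 1.
2^c*x^k≤[1+x]^k : ∀ x .{{_ : NonZero x}} c k → x * c ≤ k → 2 ^ c * x ^ k ≤ suc x ^ k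
2^c*x^k≤[1+x]^k x c k xc≤k = subst (λ t → 2 ^ c * x ^ t ≤ suc x ^ t) (m+[n∸m]≡n xc≤k) (begin
  2 ^ c * x ^ (x * c + e)          ≡⟨ cong (2 ^ c *_) (^-distribˡ-+-* x (x * c) e) ⟩
  2 ^ c * (x ^ (x * c) * x ^ e)    ≡⟨ *-assoc (2 ^ c) _ _ ⟨
  2 ^ c * x ^ (x * c) * x ^ e      ≡⟨ cong (λ t → 2 ^ c * t * x ^ e) (^-*-assoc x x c) ⟨
  2 ^ c * (x ^ x) ^ c * x ^ e      ≡⟨ cong (_* x ^ e) (^-distribʳ-* 2 (x ^ x) c) ⟨
  (2 * x ^ x) ^ c * x ^ e          ≤⟨ *-mono-≤ (^-monoˡ-≤ c (2*x^x≤[1+x]^x x)) (^-monoˡ-≤ e (n≤1+n x)) ⟩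
  (suc x ^ x) ^ c * suc x ^ e      ≡⟨ cong (_* suc x ^ e) (^-*-assoc (suc x) x c) ⟩
  suc x ^ (x * c) * suc x ^ e      ≡⟨ ^-distribˡ-+-* (suc x) (x * c) e ⟨
  suc x ^ (x * c + e)              ∎)
  where
  open ≤-Reasoning
  e = k ∸ x * c

-- Since `k ≥ x * (2 + x)`, the factor (x / (x + 1)) ^ k is at most 2 ^ -(x + 2). Its `f`-th power
-- beats 2 ^ w, which is at most 2 ^ ((x + 1) f), and leaves 2 ^ -f to spare.
few-bad : ∀ x .{{_ : NonZero x}} k f w bad N → x * (2 + x) ≤ k → w ≤ suc x * f →
          bad * suc x ^ (k * f) ≤ N * (2 ^ w * x ^ (k * f)) → bad * 2 ^ f ≤ N
few-bad x k f w bad N k≥ w≤ hyp = *-cancelʳ-≤ _ _ P {{m*n≢0 _ _ {{m^n≢0 2 (suc x * f)}} {{m^n≢0 x (k * f)}}}} (begin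
  bad * 2 ^ f * (2 ^ (suc x * f) * x ^ (k * f))
    ≡⟨ assoc₁ bad (2 ^ f) _ _ ⟩
  bad * (2 ^ f * 2 ^ (suc x * f) * x ^ (k * f))
    ≡⟨ cong (λ t → bad * (t * x ^ (k * f))) (trans (sym (^-distribˡ-+-* 2 f (suc x * f))) (sym (^-*-assoc 2 (2 + x) f))) ⟩
  bad * ((2 ^ (2 + x)) ^ f * x ^ (k * f))
    ≡⟨ cong (λ t → bad * ((2 ^ (2 + x)) ^ f * t)) (^-*-assoc x k f) ⟨
  bad * ((2 ^ (2 + x)) ^ f * (x ^ k) ^ f)
    ≡⟨ cong (bad *_) (^-distribʳ-* (2 ^ (2 + x)) (x ^ k) f) ⟨
  bad * (2 ^ (2 + x) * x ^ k) ^ f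
    ≤⟨ *-monoʳ-≤ bad (^-monoˡ-≤ f (2^c*x^k≤[1+x]^k x (2 + x) k k≥)) ⟩
  bad * (suc x ^ k) ^ f
    ≡⟨ cong (bad *_) (^-*-assoc (suc x) k f) ⟩
  bad * suc x ^ (k * f)
    ≤⟨ hyp ⟩
  N * (2 ^ w * x ^ (k * f))
    ≤⟨ *-monoʳ-≤ N (*-monoˡ-≤ (x ^ (k * f)) (^-monoʳ-≤ 2 w≤)) ⟩
  N * (2 ^ (suc x * f) * x ^ (k * f)) ∎)
  where
  open ≤-Reasoning
  P = 2 ^ (suc x * f) * x ^ (k * f)
  assoc₁ : ∀ a b c d → a * b * (c * d) ≡ a * (b * c * d)
  assoc₁ = solve-∀

-- With D the denominator of ε put q + 1 = 3 D and f = ⌊ m / (q + 1) ⌋; a path of length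
-- m - 3 f is long enough because 3 f ≤ m / D ≤ ε m.
module _ (ε : ℚ) (0<ε : 0ℚ ℚ.< ε) where

  private
    q : ℕ
    q = ℕ.pred (3 * ↧ₙ ε)

  -- The bound `x * (2 + x)` of `few-bad` at `x = 1 + 2 * q`, the value of `Q-1` in the search.
  threshold : ℕ
  threshold = (1 + 2 * q) * (3 + 2 * q)

  PrPath≥-close : ∀ {n} (G : Graph n) k .{{_ : NonZero k}} m → threshold ≤ k → k ≤ m → IsMinDegree G m →
    ∀ δ → 0ℚ ℚ.< δ → (2 + ↧ₙ δ) * suc q ≤ m →
    ℚ.∣ PrPath≥ G k ((1ℚ ℚ.- ε) ℚ.* fromℕ m) ℚ.- 1ℚ ∣ ℚ.< δ
  PrPath≥-close {n} G k m k≥ k≤m (m≤deg , v₀ , _) δ 0<δ m≥ =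
    ∣ratio-1∣<δ δ _ bad N 0<δ (length-filter+ P? (outcomes G k)) bad*D<N
    where
    open ≤-Reasoning
    f ℓ N bad : ℕ
    f = m / suc q
    -- Of the `3 * f` vertices given up, one `f` allows for dead vertices, one keeps the share 1 /
    -- (q + 1) of a neighbourhood unvisited, and one absorbs rounding.
    ℓ = m ∸ 3 * f
    N = length (outcomes G k)
    P? : ∀ ω → Dec (HasPathOfLength≥ ((1ℚ ℚ.- ε) ℚ.* fromℕ m) (ChosenAdj ω))
    P? ω = hasPathOfLength≥? ((1ℚ ℚ.- ε) ℚ.* fromℕ m) (chosenAdj? ω)
    b : Vec (Subset n) n → ℕ
    b ω = 𝟙 (¬? (P? ω))
    bad = total b (outcomes G k)

    f≥ : 2 + ↧ₙ δ ≤ f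
    f≥ = ≤-trans (≤-reflexive (sym (m*n/n≡m (2 + ↧ₙ δ) (suc q)))) (/-monoˡ-≤ (suc q) m≥)
    qf≤m : f * suc q ≤ m
    qf≤m = m/n*n≤m m (suc q)
    m<q[f+1] : m ≤ suc q * suc f
    m<q[f+1] = begin
      m                         ≡⟨ m≡m%n+[m/n]*n m (suc q) ⟩
      m % suc q + f * suc q     ≤⟨ +-monoˡ-≤ (f * suc q) (<⇒≤ (m%n<n m (suc q))) ⟩
      suc f * suc q             ≡⟨ *-comm (suc f) (suc q) ⟩
      suc q * suc f             ∎
    3fD≤m : 3 * f * ↧ₙ ε ≤ m
    3fD≤m = ≤-trans (≤-reflexive (rearrange f (↧ₙ ε))) qf≤m
      where
      rearrange : ∀ f d → 3 * f * d ≡ f * (3 * d)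
      rearrange = solve-∀
    m≡ : ℓ + 3 * f ≡ m
    m≡ = m∸n+n≡m (≤-trans (m≤m*n (3 * f) (↧ₙ ε)) 3fD≤m)
    -- The two extra units come from the strict length bound and from rounding in `m<q[f+1]`; the
    -- third `f` covers them because `2 ≤ f`.
    w+f≤m : f + suc ℓ + suc f ≤ m
    w+f≤m = begin
      f + suc ℓ + suc f    ≡⟨ rearrange f ℓ ⟩
      ℓ + 2 * f + 2        ≤⟨ +-monoʳ-≤ (ℓ + 2 * f) (≤-trans (m≤m+n 2 (↧ₙ δ)) f≥) ⟩
      ℓ + 2 * f + f        ≡⟨ rearrange′ f ℓ ⟩
      ℓ + 3 * f            ≡⟨ m≡ ⟩
      m                    ∎
      where
      rearrange : ∀ f ℓ → f + (1 + ℓ) + (1 + f) ≡ ℓ + 2 * f + 2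
      rearrange = solve-∀
      rearrange′ : ∀ f ℓ → ℓ + 2 * f + f ≡ ℓ + 3 * f
      rearrange′ = solve-∀
    w≤m : f + suc ℓ ≤ m
    w≤m = ≤-trans (m≤m+n (f + suc ℓ) (suc f)) w+f≤m
    qw≤ : suc q * (f + suc ℓ) ≤ q * m
    qw≤ = +-cancelʳ-≤ m _ _ (begin
      suc q * (f + suc ℓ) + m              ≤⟨ +-monoʳ-≤ (suc q * (f + suc ℓ)) m<q[f+1] ⟩
      suc q * (f + suc ℓ) + suc q * suc f  ≡⟨ *-distribˡ-+ (suc q) (f + suc ℓ) (suc f) ⟨
      suc q * (f + suc ℓ + suc f)          ≤⟨ *-monoʳ-≤ (suc q) w+f≤m ⟩
      m + q * m                            ≡⟨ +-comm m (q * m) ⟩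
      q * m + m                            ∎)
    -- The number of visits is linear in `f`, with the slope that `few-bad` can absorb.
    w≤Qf : f + suc ℓ ≤ suc (1 + 2 * q) * f
    w≤Qf = begin
      f + suc ℓ                ≤⟨ w≤m ⟩
      m                        ≤⟨ m<q[f+1] ⟩
      suc q * (1 + f)          ≤⟨ *-monoʳ-≤ (suc q) (+-monoˡ-≤ f (≤-trans (s≤s z≤n) f≥)) ⟩
      suc q * (f + f)          ≡⟨ rearrange q f ⟩
      suc (1 + 2 * q) * f      ∎
      where
      rearrange : ∀ q f → (1 + q) * (f + f) ≡ (1 + (1 + 2 * q)) * f
      rearrange = solve-∀
    b≡0 : ∀ ω r → ℓ ≤ r → Path (ChosenAdj ω) r → b ω ≡ 0
    b≡0 ω r ℓ≤r path = 𝟙-no (¬? (P? ω)) λ ¬P → ¬P (r , ℚ.≤-trans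
      (subst (λ t → (1ℚ ℚ.- ε) ℚ.* fromℕ t ℚ.≤ fromℕ ℓ) m≡
        ([1-ε]*m≤ ε ℓ (3 * f) 0<ε (≤-trans 3fD≤m (≤-reflexive (sym m≡)))))
      (fromℕ-mono-≤ ℓ≤r) , path)
    open Search G k b (λ ω → 𝟙≤1 (¬? (P? ω))) ℓ f q b≡0
      (λ v → ≤-trans qw≤ (*-monoʳ-≤ q (m≤deg v)))
      (≤-trans w≤m (≤-trans (m≤deg v₀) (∣p∣≤n (neighbours G v₀))))
    bad*2^f≤N : bad * 2 ^ f ≤ N
    bad*2^f≤N = few-bad (1 + 2 * q) k f (f + suc ℓ) bad N k≥ w≤Qf total-bounded
    bad*D<N : bad * ↧ₙ δ < N
    bad*D<N with bad in eq
    -- With no bad outcome the strict inequality says that the sample space is nonempty; this is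
    -- where `k ≤ m` enters.
    ... | zero  = length-outcomes>0 G k (λ v → ≤-trans k≤m (m≤deg v))
    ... | suc c = <-≤-trans (*-monoʳ-< (suc c) (≤-<-trans (≤-trans (m≤n+m (↧ₙ δ) 2) f≥) (n<2^n f)))
                    (subst (λ t → t * 2 ^ f ≤ N) eq bad*2^f≤N)

theorem3 : (ε : ℚ) → 0ℚ ℚ.< ε →
    ∃[ kε ] ((k : ℕ) → .{{NonZero k}} → kε ℕ.≤ k →
    (n : ℕ → ℕ) (G : (i : ℕ) → Graph (n i)) (m : ℕ → ℕ) →
    (∀ i → IsMinDegree (G i) (m i)) →
    TendsToInfinity n →
    TendsToInfinity m →
    ConvergesTo (λ i → PrPath≥ (G i) k ((1ℚ ℚ.- ε) ℚ.* fromℕ (m i))) 1ℚ)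
theorem3 ε 0<ε = threshold ε 0<ε , λ k k≥ n G m minDeg _ m→∞ δ 0<δ →
  -- `3 * ↧ₙ ε` computes to `suc q`. Asking for `k + M` secures both `k ≤ m i` and the lower bound
  -- on `m i` that depends on `δ`.
  let M = (2 + ↧ₙ δ) * (3 * ↧ₙ ε)
      N , m≥ = m→∞ (k + M)
  in N , λ i N≤i → PrPath≥-close ε 0<ε (G i) k (m i) k≥
       (≤-trans (m≤m+n k M) (m≥ i N≤i)) (minDeg i) δ 0<δ (≤-trans (m≤n+m M k) (m≥ i N≤i))
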